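{- Let $\varepsilon>0$. No deterministic algorithm for the fractional knapsack problem in the random-order model is $(\frac1e+\varepsilon)$-competitive.
   Context: Fractional knapsack problem: a knapsack of capacity $C>0$ and items $[n]$, each item $j$ having value $v_j>0$ and size $s_j>0$. A feasible solution is $\mathbf{x}\in[0,1]^n$ with $\sum_j s_jx_j\le C$, with value $v(\mathbf{x})=\sum_j v_jx_j$; let $\tilde{\mathbf{x}}$ denote an optimal feasible solution. Random-order model: the algorithm knows $n$ and $C$, items arrive in rounds $1,\dots,n$ in the order $\pi(1),\dots,\pi(n)$ for a uniformly random permutation $\pi$ of $[n]$; the value and size of an item are revealed upon its arrival, and the algorithm must immediately and irrevocably choose the fraction $x_{\pi(\ell)}\in[0,1]$ of the current item to pack, keeping the solution feasible. An algorithm is $\alpha$-competitive if on every instance its output satisfies $\mathbb{E}[v(\mathbf{x})]\ge(\alpha-o(1))\,v(\tilde{\mathbf{x}})$, with the expectation over $\pi$ and $o(1)$ with respect to $n\to\infty$. A deterministic algorithm is one whose decision in each round is a deterministic function of the items observed so far.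
   Formalization: Item values, sizes, the capacity and the fractions packed by the algorithm are rational instead of real, so only algorithms whose decisions are rational are covered; the ratio 1/e+ε is represented by an arbitrary rational above 1/e. -}

module Defs where

open import Data.Nat as ℕ using (ℕ; zero; suc; _!)
open import Data.Nat.Properties using (_!≢0)
open import Data.Integer using (+_)
open import Data.Rational as ℚ using (ℚ; 0ℚ; 1ℚ; _+_; _*_; _-_; -_; _≤_; _<_; _/_; _≤ᵇ_)
open import Data.Fin using (Fin)
open import Data.List using (List; []; _∷_; [_]; map; concatMap; foldr; _++_; allFin)
open import Data.Bool using (Bool; _∧_; if_then_else_)
open import Data.Product using (_×_; _,_; Σ; ∃; ∃-syntax)

sumℚ : List ℚ → ℚ
sumℚ = foldr _+_ 0ℚ

Σ[_]_ : (n : ℕ) → (Fin n → ℚ) → ℚ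
Σ[ n ] f = sumℚ (map f (allFin n))

record Instance (n : ℕ) : Set where
  field
    C     : ℚ
    v     : Fin n → ℚ
    s     : Fin n → ℚ
    C>0   : 0ℚ < C
    v>0   : ∀ j → 0ℚ < v j
    s>0   : ∀ j → 0ℚ < s j

Feasible : ∀ {n} → Instance n → (Fin n → ℚ) → Set
Feasible {n} I x =
  (∀ j → 0ℚ ≤ x j) × (∀ j → x j ≤ 1ℚ) × (Σ[ n ] (λ j → s j * x j) ≤ C)
  where open Instance I

value : ∀ {n} → Instance n → (Fin n → ℚ) → ℚ
value {n} I x = Σ[ n ] (λ j → v j * x j)
  where open Instance I

insertAll : {A : Set} → A → List A → List (List A)
insertAll x []       = (x ∷ []) ∷ []
insertAll x (y ∷ ys) = (x ∷ y ∷ ys) ∷ map (y ∷_) (insertAll x ys)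

perms : {A : Set} → List A → List (List A)
perms []       = [] ∷ []
perms (x ∷ xs) = concatMap (insertAll x) (perms xs)

-- Deterministic online algorithms.
-- On arrival of an item, the algorithm sees n, C, the (value,size) pairs
-- of all previously arrived items in arrival order, and the (value,size)
-- of the current item, and outputs the fraction to pack.  Its decision is
-- thus a deterministic function of the items observed so far.

Algorithm : Set
Algorithm = (n : ℕ) → (C : ℚ) → List (ℚ × ℚ) → (ℚ × ℚ) → ℚ

-- Running the algorithm on an arrival order.  A proposed fraction that is
-- outside [0,1] or would violate the capacity is replaced by 0, so that the
-- packed solution is always feasible.  (An algorithm that always keeps its
-- solution feasible is unaffected by this.)
run : ∀ {n} → Algorithm → Instance n → List (Fin n) → ℚ
run {n} A I = go C []
  where
  open Instance I
  go : ℚ → List (ℚ × ℚ) → List (Fin n) → ℚ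
  go rem hist []       = 0ℚ
  go rem hist (j ∷ js) =
    let it = (v j , s j)
        o  = A n C hist it
        x  = if ((0ℚ ≤ᵇ o) ∧ (o ≤ᵇ 1ℚ) ∧ (s j * o ≤ᵇ rem)) then o else 0ℚ
    in v j * x + go (rem - s j * x) (hist ++ [ it ]) js

expectedValue : ∀ {n} → Algorithm → Instance n → ℚ
expectedValue {n} A I =
  sumℚ (map (run A I) (perms (allFin n))) * ((+ 1 / (n !)) {{n !≢0}})

-- α-competitiveness: there is a function f(n) → 0 (the o(1) term) such
-- that on every instance with n items, E[v(x)] ≥ (α − f n) · v(x̃).
-- Since the optimum v(x̃) is attained by a feasible rational solution and
-- E[v(x)] ≥ 0, quantifying over all feasible x is the same as using v(x̃).

TendsToZero : (ℕ → ℚ) → Set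
TendsToZero f = ∀ (δ : ℚ) → 0ℚ < δ →
  ∃[ N ] (∀ m → N ℕ.≤ m → (- δ ≤ f m) × (f m ≤ δ))

Competitive : ℚ → Algorithm → Set
Competitive α A = ∃[ f ] (TendsToZero f ×
  (∀ n (I : Instance n) (x : Fin n → ℚ) → Feasible I x →
     (α - f n) * value I x ≤ expectedValue A I))

-- The real number 1/e: e = Σ_{i≥0} 1/i!, so 1/e < α  iff  α·e > 1
-- iff  α · Σ_{i=0}^{k} 1/i! > 1 for some k (partial sums increase to e).

eApprox : ℕ → ℚ
eApprox zero    = 1ℚ
eApprox (suc k) = eApprox k + (+ 1 / (suc k !)) {{suc k !≢0}}

invE<_ : ℚ → Set
invE< α = ∃[ k ] (1ℚ < α * eApprox k)

{-# OPTIONS --safe #-}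

-- All sizes equal the capacity, so a solution is a way of splitting one unit among the items, and the
-- values are powers of a huge κ, so only the fraction given to the most valuable item counts. The
-- exponents of the other items are drawn independently from {0,…,m}, under a law that is homogeneous in
-- m: passing from m to m+1 keeps a draw with probability q and replaces it by m+1 with probability
-- δ = 1 − q. For a fixed algorithm let h j m be the expected fraction it gives to the item m+1 when
-- this arrives after j draws, and d j m the one it gives to the j-th draw (counted from 0). Then
--   h j m + ∑_{i<j} d i m ≤ 1   and   d j (m+1) ≥ q^(j+1) d j m + δ q^j h j m.
-- Averaging over m < l telescopes the second relation: up to an error that vanishes for δ → 0 and
-- δ l → ∞, the averages satisfy h j ≤ (j+1) d j, as if the algorithm only saw relative ranks. What is
-- left is the linear program of the secretary problem, of value about n/e, whereas α-competitiveness
-- on every m makes ∑_{j<n} h j about α n.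

module Submission where

open import Defs
open import Data.Bool using (true; false; T; _∧_; if_then_else_)
open import Data.Fin using (Fin; zero; suc)
open import Data.Integer as ℤ using (-[1+_]; +≤+; -≤+)
import Data.Integer.Properties as ℤₚ
open import Data.List using (List; []; _∷_; [_]; map; concatMap; _++_; length; foldl; lookup; allFin; tabulate)
open import Data.List.Properties using (map-++; length-map; map-∘; map-tabulate; tabulate-lookup; foldl-++)
open import Data.List.Relation.Unary.All using (All; []; _∷_)
open import Data.Nat as ℕ using (ℕ; zero; suc; _!)
import Data.Nat.Properties as ℕₚ
open import Data.Nat.Properties using (_!≢0)
open import Data.Product using (_×_; _,_; proj₁; proj₂; ∃-syntax)
open import Data.Rational using (ℚ; mkℚ; 0ℚ; 1ℚ; _+_; _*_; _-_; -_; _≤_; _<_; _/_; 1/_; _≤ᵇ_; toℚᵘ; positive; nonNegative)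
open import Data.Rational.Properties
open import Data.Rational.Solver using (module +-*-Solver)
open import Data.Rational.Unnormalised as ℚᵘ using (mkℚᵘ; *≡*; *≤*)
import Data.Rational.Unnormalised.Properties as ℚᵘₚ
open import Data.Sum using (inj₁; inj₂)
open import Data.Unit using (tt)
open import Function using (_∘_; _∋_)
open import Relation.Binary.PropositionalEquality using (_≡_; refl; sym; trans; cong; cong₂; subst; subst₂; module ≡-Reasoning)
open import Relation.Nullary using (¬_)
open +-*-Solver

-- Order arithmetic of the rationals.

-- Naming the slack `d` turns an inequality into a ring identity for the solver: `d` is a
-- combination of known gaps `b - a` with nonnegative coefficients.
≤-by : ∀ {a b} d → 0ℚ ≤ d → a + d ≡ b → a ≤ b
≤-by {a} d 0≤d eq = subst₂ _≤_ (+-identityʳ a) eq (+-monoʳ-≤ a 0≤d)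

0≤-gap : ∀ {a b} → a ≤ b → 0ℚ ≤ b - a
0≤-gap {a} {b} a≤b = subst (_≤ b - a) (+-inverseʳ a) (+-monoˡ-≤ (- a) a≤b)

0≤+ : ∀ {a b} → 0ℚ ≤ a → 0ℚ ≤ b → 0ℚ ≤ a + b
0≤+ = +-mono-≤

*-monoˡ : ∀ {a b} c → 0ℚ ≤ c → a ≤ b → c * a ≤ c * b
*-monoˡ c 0≤c = *-monoˡ-≤-nonNeg c {{nonNegative 0≤c}}

*-monoʳ : ∀ {a b} c → 0ℚ ≤ c → a ≤ b → a * c ≤ b * c
*-monoʳ c 0≤c = *-monoʳ-≤-nonNeg c {{nonNegative 0≤c}}

0≤* : ∀ {a b} → 0ℚ ≤ a → 0ℚ ≤ b → 0ℚ ≤ a * b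
0≤* {a} {b} 0≤a 0≤b = subst (_≤ a * b) (*-zeroʳ a) (*-monoˡ a 0≤a 0≤b)

0≤1 : 0ℚ ≤ 1ℚ
0≤1 = nonNegative⁻¹ 1ℚ

-- Natural numbers inside the rationals and the Archimedean property.

-- Recursive, so that `ι (suc n)` unfolds to `1ℚ + ι n` in the identities given to the solver.
ι : ℕ → ℚ
ι zero    = 0ℚ
ι (suc n) = 1ℚ + ι n

0≤ι : ∀ n → 0ℚ ≤ ι n
0≤ι zero    = ≤-refl
0≤ι (suc n) = 0≤+ 0≤1 (0≤ι n)

0<ι-suc : ∀ n → 0ℚ < ι (suc n)
0<ι-suc n = <-≤-trans (positive⁻¹ 1ℚ) (≤-by (ι n) (0≤ι n) refl)

ι-mono : ∀ {m n} → m ℕ.≤ n → ι m ≤ ι n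
ι-mono {n = n} ℕ.z≤n = 0≤ι n
ι-mono (ℕ.s≤s m≤n)   = +-monoʳ-≤ 1ℚ (ι-mono m≤n)

ι-+ : ∀ m n → ι (m ℕ.+ n) ≡ ι m + ι n
ι-+ zero    n = sym (+-identityˡ (ι n))
ι-+ (suc m) n = trans (cong (1ℚ +_) (ι-+ m n)) (sym (+-assoc 1ℚ (ι m) (ι n)))

ι-* : ∀ m n → ι (m ℕ.* n) ≡ ι m * ι n
ι-* zero    n = sym (*-zeroˡ (ι n))
ι-* (suc m) n = begin
  ι (n ℕ.+ m ℕ.* n)      ≡⟨ ι-+ n (m ℕ.* n) ⟩
  ι n + ι (m ℕ.* n)      ≡⟨ cong (ι n +_) (ι-* m n) ⟩
  ι n + ι m * ι n        ≡⟨ solve 2 (λ a b → b :+ a :* b := (con 1ℚ :+ a) :* b) refl (ι m) (ι n) ⟩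
  (1ℚ + ι m) * ι n       ∎
  where open ≡-Reasoning

toℚᵘ-ι : ∀ n → toℚᵘ (ι n) ℚᵘ.≃ mkℚᵘ (ℤ.+ n) 0
toℚᵘ-ι zero    = *≡* refl
toℚᵘ-ι (suc n) =
  ℚᵘₚ.≃-trans (toℚᵘ-homo-+ 1ℚ (ι n))
    (ℚᵘₚ.≃-trans (ℚᵘₚ.+-congʳ (toℚᵘ 1ℚ) (toℚᵘ-ι n))
      (*≡* (cong (ℤ._* ℤ.+ 1) (cong (λ z → ℤ.+ 1 ℤ.+ z) (ℤₚ.*-identityʳ (ℤ.+ n))))))

ι-inverse : ∀ n .{{_ : ℕ.NonZero n}} → ι n * (ℤ.+ 1 / n) ≡ 1ℚ
ι-inverse n@(suc k) = toℚᵘ-injective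
  (ℚᵘₚ.≃-trans (toℚᵘ-homo-* (ι n) (ℤ.+ 1 / n))
    (ℚᵘₚ.≃-trans (ℚᵘₚ.*-cong (toℚᵘ-ι n) (toℚᵘ-fromℚᵘ (mkℚᵘ (ℤ.+ 1) k)))
      (*≡* (trans (ℤₚ.*-identityʳ _)
        (trans (ℤₚ.*-identityʳ (ℤ.+ n)) (cong ℤ.+_ (sym (trans (ℕₚ.+-identityʳ _) (ℕₚ.+-identityʳ n)))))))))

ι-unbounded : ∀ p → ∃[ N ] p ≤ ι N
ι-unbounded p@(mkℚ num d _) = ℤ.∣ num ∣ , toℚᵘ-cancel-≤
  (ℚᵘₚ.≤-respʳ-≃ (ℚᵘₚ.≃-sym (toℚᵘ-ι ℤ.∣ num ∣)) (*≤* (bound num)))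
  where
  bound : ∀ z → z ℤ.* ℤ.+ 1 ℤ.≤ ℤ.+ ℤ.∣ z ∣ ℤ.* ℤ.+ suc d
  bound (ℤ.+ n)    = subst₂ ℤ._≤_ (sym (ℤₚ.*-identityʳ (ℤ.+ n))) (ℤₚ.pos-* n (suc d)) (+≤+ (ℕₚ.m≤m*n n (suc d)))
  bound -[1+ n ] = -≤+

inverse : ∀ {p} → 0ℚ < p → ∃[ r ] (0ℚ < r × p * r ≡ 1ℚ)
inverse {p} 0<p =
  (1/ p) {{nz}} , positive⁻¹ _ {{1/pos⇒pos p {{positive 0<p}}}} , *-inverseʳ p {{nz}}
  where nz = pos⇒nonZero p {{positive 0<p}}

-- The successor keeps the witness positive: κ and ρ of the main proof, which are inverted, and `L`,
-- which is cancelled, all arise here.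
archimedean : ∀ {p} → 0ℚ < p → ∀ b → ∃[ N ] b ≤ p * ι (suc N)
archimedean {p} 0<p b with inverse 0<p
... | r , 0<r , pr≡1 with ι-unbounded (b * r)
... | N , br≤N = N , ≤-trans (≤-reflexive eq)
    (*-monoˡ p (<⇒≤ 0<p) (≤-trans br≤N (ι-mono (ℕₚ.n≤1+n N))))
  where
  eq : b ≡ p * (b * r)
  eq = trans (sym (*-identityʳ b)) (trans (cong (b *_) (sym pr≡1))
    (solve 3 (λ p b r → b :* (p :* r) := p :* (b :* r)) refl p b r))

-- Powers, Bernoulli's inequality and convexity.

pow : ℚ → ℕ → ℚ
pow x zero    = 1ℚ
pow x (suc n) = x * pow x n

0≤pow : ∀ {x} → 0ℚ ≤ x → ∀ n → 0ℚ ≤ pow x n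
0≤pow 0≤x zero    = 0≤1
0≤pow 0≤x (suc n) = 0≤* 0≤x (0≤pow 0≤x n)

pow-1 : ∀ n → pow 1ℚ n ≡ 1ℚ
pow-1 zero    = refl
pow-1 (suc n) = trans (*-identityˡ (pow 1ℚ n)) (pow-1 n)

pow-mono : ∀ {x y} → 0ℚ ≤ x → x ≤ y → ∀ n → pow x n ≤ pow y n
pow-mono 0≤x x≤y zero    = ≤-refl
pow-mono {x} {y} 0≤x x≤y (suc n) =
  ≤-trans (*-monoʳ (pow x n) (0≤pow 0≤x n) x≤y) (*-monoˡ y (≤-trans 0≤x x≤y) (pow-mono 0≤x x≤y n))

0<pow : ∀ {x} → 1ℚ ≤ x → ∀ n → 0ℚ < pow x n
0<pow 1≤x zero    = positive⁻¹ 1ℚ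
0<pow {x} 1≤x (suc n) = <-≤-trans (0<pow 1≤x n)
  (subst (_≤ x * pow x n) (*-identityˡ (pow x n)) (*-monoʳ (pow x n) (<⇒≤ (0<pow 1≤x n)) 1≤x))

pow-monoʳ : ∀ {x} → 1ℚ ≤ x → ∀ {m n} → m ℕ.≤ n → pow x m ≤ pow x n
pow-monoʳ 1≤x {n = zero}  ℕ.z≤n = ≤-refl
pow-monoʳ {x} 1≤x {n = suc n} ℕ.z≤n = ≤-trans (pow-monoʳ 1≤x {0} {n} ℕ.z≤n)
  (subst (_≤ x * pow x n) (*-identityˡ (pow x n)) (*-monoʳ (pow x n) (<⇒≤ (0<pow 1≤x n)) 1≤x))
pow-monoʳ {x} 1≤x (ℕ.s≤s m≤n) = *-monoˡ x (≤-trans 0≤1 1≤x) (pow-monoʳ 1≤x m≤n)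

bernoulli : ∀ {q δ} → 0ℚ ≤ q → 0ℚ ≤ δ → q + δ ≡ 1ℚ → ∀ j → 1ℚ ≤ pow q j + ι j * δ
bernoulli {q} {δ} _ _ _ zero = ≤-reflexive (solve 1 (λ δ → con 1ℚ := con 1ℚ :+ con 0ℚ :* δ) refl δ)
bernoulli {q} {δ} 0≤q 0≤δ q+δ≡1 (suc j) = begin
  1ℚ                                      ≡⟨ q+δ≡1 ⟨
  q + δ                                   ≡⟨ cong (_+ δ) (*-identityʳ q) ⟨
  q * 1ℚ + δ                              ≤⟨ +-monoˡ-≤ δ (*-monoˡ q 0≤q (bernoulli 0≤q 0≤δ q+δ≡1 j)) ⟩
  -- The added term completes q (j δ) to j δ through q + δ = 1.
  q * (pow q j + ι j * δ) + δ             ≤⟨ ≤-by (δ * (ι j * δ)) (0≤* 0≤δ (0≤* (0≤ι j) 0≤δ)) refl ⟩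
  q * (pow q j + ι j * δ) + δ + δ * (ι j * δ)
    ≡⟨ solve 4 (λ q δ w J → q :* (w :+ J :* δ) :+ δ :+ δ :* (J :* δ)
         := q :* w :+ (q :+ δ) :* (J :* δ) :+ δ) refl q δ (pow q j) (ι j) ⟩
  q * pow q j + (q + δ) * (ι j * δ) + δ   ≡⟨ cong (λ z → q * pow q j + z * (ι j * δ) + δ) q+δ≡1 ⟩
  q * pow q j + 1ℚ * (ι j * δ) + δ
    ≡⟨ solve 3 (λ w J δ → w :+ con 1ℚ :* (J :* δ) :+ δ := w :+ (con 1ℚ :+ J) :* δ) refl (q * pow q j) (ι j) δ ⟩
  q * pow q j + ι (suc j) * δ             ∎
  where open ≤-Reasoning

-- The convex function y^(i+1) lies above its tangent at `s + x`; this is read off at the point `s`.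
pow-convex : ∀ {s x} → 0ℚ ≤ s → 0ℚ ≤ x → ∀ i →
  pow (s + x) (suc i) ≤ pow s (suc i) + x * (ι (suc i) * pow (s + x) i)
pow-convex {s} {x} 0≤s 0≤x zero = ≤-reflexive
  (solve 2 (λ s x → (s :+ x) :* con 1ℚ := s :* con 1ℚ :+ x :* ((con 1ℚ :+ con 0ℚ) :* con 1ℚ)) refl s x)
pow-convex {s} {x} 0≤s 0≤x (suc i) =
  ≤-trans (*-monoˡ (s + x) (0≤+ 0≤s 0≤x) (pow-convex 0≤s 0≤x i))
    (≤-by (x * (pow (s + x) (suc i) - pow s (suc i)))
      (0≤* 0≤x (0≤-gap (pow-mono 0≤s (≤-by x 0≤x refl) (suc i))))
      (solve 5 (λ s x n p r →
        (s :+ x) :* (p :+ x :* (n :* r)) :+ x :* ((s :+ x) :* r :- p)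
          := s :* p :+ x :* ((con 1ℚ :+ n) :* ((s :+ x) :* r)))
        refl s x (ι (suc i)) (pow s (suc i)) (pow (s + x) i)))

-- The truncated exponential series.

invFact : ℕ → ℚ
invFact k = (ℤ.+ 1 / (k !)) {{k !≢0}}

ι-invFact : ∀ k → ι (k !) * invFact k ≡ 1ℚ
ι-invFact k = ι-inverse (k !) {{k !≢0}}

0≤invFact : ∀ k → 0ℚ ≤ invFact k
0≤invFact k = nonNegative⁻¹ _ {{normalize-nonNeg 1 (k !) {{k !≢0}}}}

invFact-suc : ∀ k → ι (suc k) * invFact (suc k) ≡ invFact k
invFact-suc k = begin
  N * c′             ≡⟨ *-identityˡ (N * c′) ⟨
  1ℚ * (N * c′)      ≡⟨ cong (_* (N * c′)) (ι-invFact k) ⟨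
  F * c * (N * c′)   ≡⟨ solve 4 (λ F c N c′ → F :* c :* (N :* c′) := N :* F :* c′ :* c) refl F c N c′ ⟩
  N * F * c′ * c     ≡⟨ cong (λ z → z * c′ * c) (ι-* (suc k) (k !)) ⟨
  ι (suc k !) * c′ * c ≡⟨ cong (_* c) (ι-invFact (suc k)) ⟩
  1ℚ * c             ≡⟨ *-identityˡ c ⟩
  c                  ∎
  where
  open ≡-Reasoning
  N = ι (suc k)
  F = ι (k !)
  c = invFact k
  c′ = invFact (suc k)

-- The Taylor polynomial of exp of degree `k`, a rational stand-in for exp whose value at 1 is
-- `eApprox k`.
texp : ℕ → ℚ → ℚ
texp zero    x = 1ℚ
texp (suc k) x = texp k x + pow x (suc k) * invFact (suc k)

texp-1 : ∀ k → texp k 1ℚ ≡ eApprox k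
texp-1 zero    = refl
texp-1 (suc k) = cong₂ _+_ (texp-1 k)
  (trans (cong (_* invFact (suc k)) (pow-1 (suc k))) (*-identityˡ (invFact (suc k))))

texp-0 : ∀ k → texp k 0ℚ ≡ 1ℚ
texp-0 zero    = refl
texp-0 (suc k) = trans (cong₂ _+_ (texp-0 k)
  (trans (cong (_* invFact (suc k)) (*-zeroˡ (pow 0ℚ k))) (*-zeroˡ (invFact (suc k)))))
  (+-identityʳ 1ℚ)

texp-mono : ∀ k {x y} → 0ℚ ≤ x → x ≤ y → texp k x ≤ texp k y
texp-mono zero    0≤x x≤y = ≤-refl
texp-mono (suc k) 0≤x x≤y = +-mono-≤ (texp-mono k 0≤x x≤y)
  (*-monoʳ (invFact (suc k)) (0≤invFact (suc k)) (pow-mono 0≤x x≤y (suc k)))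

1≤texp : ∀ k {x} → 0ℚ ≤ x → 1ℚ ≤ texp k x
1≤texp k 0≤x = subst (_≤ texp k _) (texp-0 k) (texp-mono k ≤-refl 0≤x)

-- The sharper form, with the last term of texp k removed, is what the induction on k needs.
texp-increment : ∀ k {s x} → 0ℚ ≤ s → 0ℚ ≤ x →
  texp k (s + x) ≤ texp k s + x * (texp k (s + x) - pow (s + x) k * invFact k)
texp-increment zero {s} {x} 0≤s 0≤x = ≤-reflexive
  (solve 1 (λ x → con 1ℚ := con 1ℚ :+ x :* (con 1ℚ :- con 1ℚ :* con 1ℚ)) refl x)
texp-increment (suc k) {s} {x} 0≤s 0≤x =
  ≤-trans (+-mono-≤ (texp-increment k 0≤s 0≤x)
            (*-monoʳ c′ (0≤invFact (suc k)) (pow-convex 0≤s 0≤x k)))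
    (≤-reflexive (trans
      (cong (λ z → texp k s + x * (texp k (s + x) - p * z) + (pow s (suc k) + x * (ι (suc k) * p)) * c′)
            (sym (invFact-suc k)))
      (solve 8 (λ s x T t p r N c′ →
        t :+ x :* (T :- p :* (N :* c′)) :+ (r :+ x :* (N :* p)) :* c′
          := t :+ r :* c′ :+ x :* (T :+ (s :+ x) :* p :* c′ :- (s :+ x) :* p :* c′))
        refl s x (texp k (s + x)) (texp k s) p (pow s (suc k)) (ι (suc k)) c′)))
  where
  p = pow (s + x) k
  c′ = invFact (suc k)

-- For exp itself this is 1 - x ≤ exp (-x). With x = 1/j it carries the bound on the harmonic sum u
-- through one more summand.
texp-shift : ∀ k {s x} → 0ℚ ≤ s → 0ℚ ≤ x → texp k (s + x) * (1ℚ - x) ≤ texp k s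
texp-shift k {s} {x} 0≤s 0≤x =
  ≤-by (g + x * (pow (s + x) k * invFact k))
    (0≤+ (0≤-gap (texp-increment k 0≤s 0≤x))
         (0≤* 0≤x (0≤* (0≤pow (0≤+ 0≤s 0≤x) k) (0≤invFact k))))
    (solve 4 (λ T t x w → T :* (con 1ℚ :- x) :+ (t :+ x :* (T :- w) :- T :+ x :* w) := t)
      refl (texp k (s + x)) (texp k s) x (pow (s + x) k * invFact k))
  where
  g = texp k s + x * (texp k (s + x) - pow (s + x) k * invFact k) - texp k (s + x)

-- Finite sums.

∑ : ℕ → (ℕ → ℚ) → ℚ
∑ zero    f = 0ℚ
∑ (suc n) f = ∑ n f + f n

∑-mono : ∀ n {f g : ℕ → ℚ} → (∀ i → i ℕ.< n → f i ≤ g i) → ∑ n f ≤ ∑ n g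
∑-mono zero    f≤g = ≤-refl
∑-mono (suc n) f≤g = +-mono-≤ (∑-mono n (λ i i<n → f≤g i (ℕₚ.m<n⇒m<1+n i<n))) (f≤g n ℕₚ.≤-refl)

0≤∑ : ∀ n {f : ℕ → ℚ} → (∀ i → 0ℚ ≤ f i) → 0ℚ ≤ ∑ n f
0≤∑ zero    0≤f = ≤-refl
0≤∑ (suc n) 0≤f = 0≤+ (0≤∑ n 0≤f) (0≤f n)

∑-+ : ∀ n (f g : ℕ → ℚ) → ∑ n (λ i → f i + g i) ≡ ∑ n f + ∑ n g
∑-+ zero    f g = refl
∑-+ (suc n) f g = trans (cong (_+ (f n + g n)) (∑-+ n f g))
  (solve 4 (λ a b x y → a :+ b :+ (x :+ y) := a :+ x :+ (b :+ y)) refl (∑ n f) (∑ n g) (f n) (g n))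

∑-*ˡ : ∀ n c (f : ℕ → ℚ) → ∑ n (λ i → c * f i) ≡ c * ∑ n f
∑-*ˡ zero    c f = sym (*-zeroʳ c)
∑-*ˡ (suc n) c f = trans (cong (_+ c * f n) (∑-*ˡ n c f)) (sym (*-distribˡ-+ c (∑ n f) (f n)))

∑-const : ∀ n c → ∑ n (λ _ → c) ≡ ι n * c
∑-const zero    c = sym (*-zeroˡ c)
∑-const (suc n) c = trans (cong (_+ c) (∑-const n c))
  (solve 2 (λ a c → a :* c :+ c := (con 1ℚ :+ a) :* c) refl (ι n) c)

∑-swap : ∀ m n (f : ℕ → ℕ → ℚ) → ∑ m (λ i → ∑ n (f i)) ≡ ∑ n (λ j → ∑ m (λ i → f i j))
∑-swap zero    n f = sym (trans (∑-const n 0ℚ) (*-zeroʳ (ι n)))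
∑-swap (suc m) n f = trans (cong (_+ ∑ n (f m)) (∑-swap m n f)) (sym (∑-+ n (λ j → ∑ m (λ i → f i j)) (f m)))

∑-head : ∀ n (f : ℕ → ℚ) → ∑ (suc n) f ≡ f 0 + ∑ n (λ i → f (suc i))
∑-head zero    f = trans (+-identityˡ (f 0)) (sym (+-identityʳ (f 0)))
∑-head (suc n) f = trans (cong (_+ f (suc n)) (∑-head n f))
  (+-assoc (f 0) (∑ n (λ i → f (suc i))) (f (suc n)))

-- The linear program of the secretary problem.

-- Σ c over the positions from i on is at most a slope W times the unused budget L − ∑ i σ, up to
-- errors e. Going down from i = n, W = i u with u = 1/i + … + 1/(n−1) while u ≤ 1 (the secretary
-- rule then selects every record), and W stays constant afterwards (it selects nothing). Since
-- u passes 1 when i is about n/e, this constant is about n/e.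
module _ (k n : ℕ) (c σ : ℕ → ℚ) (e L : ℚ)
  (0≤e : 0ℚ ≤ e) (0≤σ : ∀ i → 0ℚ ≤ σ i)
  (c≤σ : ∀ i → i ℕ.< n → c i ≤ ι (suc i) * σ i + e)
  (budget : ∀ i → c i + ∑ i σ ≤ L)
  where

  private
    τ = texp k 1ℚ
    N = ι n

    0≤τ : 0ℚ ≤ τ
    0≤τ = ≤-trans 0≤1 (1≤texp k 0≤1)

  TailBound : ℕ → ℚ → Set
  TailBound i W = ∑ n c ≤ ∑ i c + (N - ι i) * e + W * (L - ∑ i σ)

  -- The inequality in `selecting` says (i - 1) exp u ≤ n with `texp k` for exp, which is the
  -- harmonic bound u ≤ log (n / (i - 1)) without a logarithm. The one in `waiting` says W ≤ n/τ +
  -- 2.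
  data Slope (i : ℕ) : ℚ → Set where
    selecting : ∀ u → 0ℚ ≤ u → u ≤ 1ℚ → ι i * texp k u ≤ N + texp k u → Slope i (ι i * u)
    waiting   : ∀ W → ι i ≤ W → W * τ ≤ N + (1ℚ + 1ℚ) * τ → Slope i W

  -- Bound `c j` by the budget with weight 1 - u and by the comparison with `σ j` with weight u. The
  -- terms in `σ j` cancel, and L - ∑ j σ gets the coefficient (j+1) u + (1 - u) = 1 + j u.
  tail-selecting : ∀ j u → 0ℚ ≤ u → u ≤ 1ℚ → suc j ℕ.≤ n →
    TailBound (suc j) (ι (suc j) * u) → TailBound j (1ℚ + ι j * u)
  tail-selecting j u 0≤u u≤1 j<n bound = ≤-trans bound
    (≤-by ((1ℚ - u) * (L - (c j + ∑ j σ)) + u * (ι (suc j) * σ j + e - c j) + (1ℚ - u) * e)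
      (0≤+ (0≤+ (0≤* (0≤-gap u≤1) (0≤-gap (budget j)))
                (0≤* 0≤u (0≤-gap (c≤σ j j<n))))
           (0≤* (0≤-gap u≤1) 0≤e))
      (solve 9 (λ C cⱼ S s N J e L u →
        C :+ cⱼ :+ (N :- (con 1ℚ :+ J)) :* e :+ (con 1ℚ :+ J) :* u :* (L :- (S :+ s))
          :+ ((con 1ℚ :- u) :* (L :- (cⱼ :+ S)) :+ u :* ((con 1ℚ :+ J) :* s :+ e :- cⱼ) :+ (con 1ℚ :- u) :* e)
        := C :+ (N :- J) :* e :+ (con 1ℚ :+ J :* u) :* (L :- S))
        refl (∑ j c) (c j) (∑ j σ) (σ j) N (ι j) e L u))

  -- Spending `σ j` lowers the bound by W `σ j`, and since W ≥ j + 1 this already pays for `c j` up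
  -- to `e`.
  tail-waiting : ∀ j W → ι (suc j) ≤ W → suc j ℕ.≤ n → TailBound (suc j) W → TailBound j W
  tail-waiting j W j<W j<n bound = ≤-trans bound
    (≤-by ((W - ι (suc j)) * σ j + (ι (suc j) * σ j + e - c j))
      (0≤+ (0≤* (0≤-gap j<W) (0≤σ j)) (0≤-gap (c≤σ j j<n)))
      (solve 9 (λ C cⱼ S s N J e L W →
        C :+ cⱼ :+ (N :- (con 1ℚ :+ J)) :* e :+ W :* (L :- (S :+ s))
          :+ ((W :- (con 1ℚ :+ J)) :* s :+ ((con 1ℚ :+ J) :* s :+ e :- cⱼ))
        := C :+ (N :- J) :* e :+ W :* (L :- S))
        refl (∑ j c) (c j) (∑ j σ) (σ j) N (ι j) e L W))

  slope-selecting : ∀ j u → 0ℚ ≤ u → u ≤ 1ℚ → ι (suc j) * texp k u ≤ N + texp k u →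
    Slope j (1ℚ + ι j * u)
  -- There is no summand 1/j at j = 0; the slope is 1 there, which the bound for waiting allows.
  slope-selecting zero u 0≤u u≤1 _ = waiting (1ℚ + 0ℚ * u)
    (≤-by 1ℚ 0≤1 (solve 1 (λ u → con 0ℚ :+ con 1ℚ := con 1ℚ :+ con 0ℚ :* u) refl u))
    (≤-by (N + τ) (0≤+ (0≤ι n) 0≤τ)
      (solve 3 (λ u τ N → (con 1ℚ :+ con 0ℚ :* u) :* τ :+ (N :+ τ) := N :+ (con 1ℚ :+ con 1ℚ) :* τ)
        refl u τ N))
  slope-selecting (suc j) u 0≤u u≤1 bound with inverse (0<ι-suc j)
  ... | r , 0<r , Jr≡1 = result
    where
    J = ι (suc j)
    u′ = u + r
    0≤r = <⇒≤ 0<r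

    slope≡ : J * u′ ≡ 1ℚ + J * u
    slope≡ = trans (*-distribˡ-+ J u r) (trans (cong (J * u +_) Jr≡1) (+-comm (J * u) 1ℚ))

    bound′ : J * texp k u′ ≤ N + texp k u′
    bound′ = begin
      J * t′
        ≡⟨ solve 3 (λ J t r → J :* t := J :* (t :* (con 1ℚ :- r)) :+ J :* r :* t) refl J t′ r ⟩
      J * (t′ * (1ℚ - r)) + J * r * t′ ≤⟨ +-mono-≤ (*-monoˡ J (0≤ι (suc j)) (texp-shift k 0≤u 0≤r))
                                              (≤-reflexive (trans (cong (_* t′) Jr≡1) (*-identityˡ t′))) ⟩
      J * t + t′
        ≡⟨ solve 3 (λ J t t′ → J :* t :+ t′ := (con 1ℚ :+ J) :* t :+ (t′ :- t)) refl J t t′ ⟩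
      (1ℚ + J) * t + (t′ - t)       ≤⟨ +-monoˡ-≤ (t′ - t) bound ⟩
      N + t + (t′ - t)              ≡⟨ solve 3 (λ N t t′ → N :+ t :+ (t′ :- t) := N :+ t′) refl N t t′ ⟩
      N + t′                        ∎
      where
      open ≤-Reasoning
      t = texp k u
      t′ = texp k u′

    0≤ι[j] : 0ℚ ≤ J - 1ℚ
    0≤ι[j] = 0≤-gap {1ℚ} {J} (≤-by (ι j) (0≤ι j) refl)

    boundτ : 1ℚ ≤ u′ → (J - 1ℚ) * τ ≤ N
    boundτ 1≤u′ = ≤-trans (*-monoˡ (J - 1ℚ) 0≤ι[j] (texp-mono k 0≤1 1≤u′))
      (≤-by (N + texp k u′ - J * texp k u′) (0≤-gap bound′)
        (solve 3 (λ J t N → (J :- con 1ℚ) :* t :+ (N :+ t :- J :* t) := N) refl J (texp k u′) N))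

    result : Slope (suc j) (1ℚ + J * u)
    result with ≤-total u′ 1ℚ
    ... | inj₁ u′≤1 = subst (Slope (suc j)) slope≡ (selecting u′ (0≤+ 0≤u 0≤r) u′≤1 bound′)
    -- As u ≤ 1, the slope is at most (J - 1) + 2, and (J - 1) τ ≤ N because u′ has passed 1. This
    -- is where the additive 2 in the bound on W comes from.
    ... | inj₂ 1≤u′ = waiting (1ℚ + J * u)
      (subst₂ _≤_ (*-identityʳ J) slope≡ (*-monoˡ J (0≤ι (suc j)) 1≤u′))
      (≤-by (N - (J - 1ℚ) * τ + J * τ * (1ℚ - u))
        (0≤+ (0≤-gap (boundτ 1≤u′)) (0≤* (0≤* (0≤ι (suc j)) 0≤τ) (0≤-gap u≤1)))
        (solve 4 (λ J u τ N → (con 1ℚ :+ J :* u) :* τ :+ (N :- (J :- con 1ℚ) :* τ :+ J :* τ :* (con 1ℚ :- u))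
          := N :+ (con 1ℚ :+ con 1ℚ) :* τ) refl J u τ N))

  -- The recursion on `d` descends from i = n, where the tail is empty and u = 0.
  tails : ∀ i d → i ℕ.+ d ≡ n → ∃[ W ] (Slope i W × TailBound i W)
  tails i zero i+0≡n rewrite trans (sym (ℕₚ.+-identityʳ i)) i+0≡n =
    N * 0ℚ ,
    selecting 0ℚ ≤-refl 0≤1
      (≤-by (texp k 0ℚ) (≤-trans 0≤1 (1≤texp k ≤-refl))
        (cong (_+ texp k 0ℚ) (trans (cong (N *_) (texp-0 k)) (*-identityʳ N)))) ,
    ≤-reflexive (solve 5 (λ C N e L S → C := C :+ (N :- N) :* e :+ N :* con 0ℚ :* (L :- S))
      refl (∑ n c) N e L (∑ n σ))
  tails j (suc d) j+1+d≡n with trans (sym (ℕₚ.+-suc j d)) j+1+d≡n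
  ... | eq with subst (suc j ℕ.≤_) eq (ℕₚ.m≤m+n (suc j) d) | tails (suc j) d eq
  ... | j<n | _ , selecting u 0≤u u≤1 bound , tail =
    _ , slope-selecting j u 0≤u u≤1 bound , tail-selecting j u 0≤u u≤1 j<n tail
  ... | j<n | _ , waiting W j≤W bound , tail =
    W , waiting W (≤-trans (≤-by 1ℚ 0≤1 (+-comm (ι j) 1ℚ)) j≤W) bound ,
    tail-waiting j W j≤W j<n tail

  secretary-bound : ∃[ W ] (W * τ ≤ N + (1ℚ + 1ℚ) * τ × ∑ n c ≤ N * e + W * L)
  secretary-bound with tails 0 n refl
  ... | W , slope , tail = W , slopeBound slope ,
    ≤-trans tail (≤-reflexive
      (solve 4 (λ N e W L → con 0ℚ :+ (N :- con 0ℚ) :* e :+ W :* (L :- con 0ℚ) := N :* e :+ W :* L)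
        refl N e W L))
    where
    slopeBound : ∀ {W} → Slope 0 W → W * τ ≤ N + (1ℚ + 1ℚ) * τ
    slopeBound (waiting _ _ bound) = bound
    -- At i = 0 a selecting slope is 0 * u, so the bound is free.
    slopeBound (selecting u _ _ _) =
      ≤-by (N + (1ℚ + 1ℚ) * τ) (0≤+ (0≤ι n) (0≤* (0≤+ 0≤1 0≤1) 0≤τ))
        (solve 3 (λ u τ N → con 0ℚ :* u :* τ :+ (N :+ (con 1ℚ :+ con 1ℚ) :* τ)
          := N :+ (con 1ℚ :+ con 1ℚ) :* τ) refl u τ N)

-- Sums over lists, insertions and permutations.

sumOver : {A : Set} → List A → (A → ℚ) → ℚ
sumOver xs φ = sumℚ (map φ xs)

module _ {A : Set} where

  sumOver-++ : ∀ xs ys (φ : A → ℚ) → sumOver (xs ++ ys) φ ≡ sumOver xs φ + sumOver ys φ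
  sumOver-++ []       ys φ = sym (+-identityˡ (sumOver ys φ))
  sumOver-++ (x ∷ xs) ys φ = trans (cong (φ x +_) (sumOver-++ xs ys φ))
    (sym (+-assoc (φ x) (sumOver xs φ) (sumOver ys φ)))

  sumOver-cong : ∀ xs {φ ψ : A → ℚ} → (∀ x → φ x ≡ ψ x) → sumOver xs φ ≡ sumOver xs ψ
  sumOver-cong []       eq = refl
  sumOver-cong (x ∷ xs) eq = cong₂ _+_ (eq x) (sumOver-cong xs eq)

  sumOver-map : {B : Set} (f : B → A) → ∀ xs (φ : A → ℚ) → sumOver (map f xs) φ ≡ sumOver xs (φ ∘ f)
  sumOver-map f xs φ = cong sumℚ (sym (map-∘ xs))

  sumOver-concatMap : {B : Set} (F : B → List A) → ∀ xs (φ : A → ℚ) →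
    sumOver (concatMap F xs) φ ≡ sumOver xs (λ x → sumOver (F x) φ)
  sumOver-concatMap F []       φ = refl
  sumOver-concatMap F (x ∷ xs) φ = trans (sumOver-++ (F x) (concatMap F xs) φ)
    (cong (sumOver (F x) φ +_) (sumOver-concatMap F xs φ))

  sumOver-shift : ∀ xs c (φ : A → ℚ) → sumOver xs (λ x → c + φ x) ≡ ι (length xs) * c + sumOver xs φ
  sumOver-shift []       c φ = solve 1 (λ c → con 0ℚ := con 0ℚ :* c :+ con 0ℚ) refl c
  sumOver-shift (x ∷ xs) c φ = trans (cong (c + φ x +_) (sumOver-shift xs c φ))
    (solve 4 (λ c y n s → c :+ y :+ (n :* c :+ s) := (con 1ℚ :+ n) :* c :+ (y :+ s))
      refl c (φ x) (ι (length xs)) (sumOver xs φ))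

  length-insertAll : ∀ (x : A) ys → length (insertAll x ys) ≡ suc (length ys)
  length-insertAll x []       = refl
  length-insertAll x (y ∷ ys) = cong suc (trans (length-map (y ∷_) (insertAll x ys)) (length-insertAll x ys))

module _ {A B : Set} (f : A → B) where

  insertAll-map : ∀ x ys → insertAll (f x) (map f ys) ≡ map (map f) (insertAll x ys)
  insertAll-map x []       = refl
  insertAll-map x (y ∷ ys) = cong ((f x ∷ f y ∷ map f ys) ∷_) (begin
    map (f y ∷_) (insertAll (f x) (map f ys))    ≡⟨ cong (map (f y ∷_)) (insertAll-map x ys) ⟩
    map (f y ∷_) (map (map f) (insertAll x ys))  ≡⟨ map-∘ (insertAll x ys) ⟨
    map (map f ∘ (y ∷_)) (insertAll x ys)        ≡⟨ map-∘ (insertAll x ys) ⟩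
    map (map f) (map (y ∷_) (insertAll x ys))    ∎)
    where open ≡-Reasoning

  -- Naturality of `perms`: it turns the arrival orders of item indices into arrival orders of
  -- exponents.
  perms-map : ∀ xs → perms (map f xs) ≡ map (map f) (perms xs)
  perms-map []       = refl
  perms-map (x ∷ xs) = trans (cong (concatMap (insertAll (f x))) (perms-map xs)) (insertions (perms xs))
    where
    insertions : ∀ yss → concatMap (insertAll (f x)) (map (map f) yss) ≡ map (map f) (concatMap (insertAll x) yss)
    insertions []         = refl
    insertions (ys ∷ yss) = trans (cong₂ _++_ (insertAll-map x ys) (insertions yss))
      (sym (map-++ (map f) (insertAll x ys) (concatMap (insertAll x) yss)))

-- Expectations over independent draws.

module Draws (q δ : ℚ) (0≤q : 0ℚ ≤ q) (0≤δ : 0ℚ ≤ δ) (q+δ≡1 : q + δ ≡ 1ℚ) where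

  -- A truncated geometric law seen from the top: the value 0 has weight q^m, and each a from 1 to m
  -- has weight δ q^(m-a).
  𝔼 : ℕ → (ℕ → ℚ) → ℚ
  𝔼 zero    φ = φ 0
  𝔼 (suc m) φ = q * 𝔼 m φ + δ * φ (suc m)

  𝔼-mono : ∀ m {φ ψ : ℕ → ℚ} → (∀ a → a ℕ.≤ m → φ a ≤ ψ a) → 𝔼 m φ ≤ 𝔼 m ψ
  𝔼-mono zero    φ≤ψ = φ≤ψ 0 ℕ.z≤n
  𝔼-mono (suc m) φ≤ψ = +-mono-≤
    (*-monoˡ q 0≤q (𝔼-mono m (λ a a≤m → φ≤ψ a (ℕₚ.m≤n⇒m≤1+n a≤m))))
    (*-monoˡ δ 0≤δ (φ≤ψ (suc m) ℕₚ.≤-refl))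

  𝔼-cong : ∀ m {φ ψ : ℕ → ℚ} → (∀ a → φ a ≡ ψ a) → 𝔼 m φ ≡ 𝔼 m ψ
  𝔼-cong zero    eq = eq 0
  𝔼-cong (suc m) eq = cong₂ (λ x y → q * x + δ * y) (𝔼-cong m eq) (eq (suc m))

  𝔼-const : ∀ m c → 𝔼 m (λ _ → c) ≡ c
  𝔼-const zero    c = refl
  𝔼-const (suc m) c = begin
    q * 𝔼 m (λ _ → c) + δ * c  ≡⟨ cong (λ z → q * z + δ * c) (𝔼-const m c) ⟩
    q * c + δ * c              ≡⟨ *-distribʳ-+ c q δ ⟨
    (q + δ) * c                ≡⟨ cong (_* c) q+δ≡1 ⟩
    1ℚ * c                     ≡⟨ *-identityˡ c ⟩
    c                          ∎
    where open ≡-Reasoning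

  𝔼-+ : ∀ m (φ ψ : ℕ → ℚ) → 𝔼 m (λ a → φ a + ψ a) ≡ 𝔼 m φ + 𝔼 m ψ
  𝔼-+ zero    φ ψ = refl
  𝔼-+ (suc m) φ ψ = trans (cong (λ z → q * z + δ * (φ (suc m) + ψ (suc m))) (𝔼-+ m φ ψ))
    (solve 6 (λ q δ x y u v → q :* (x :+ y) :+ δ :* (u :+ v) := q :* x :+ δ :* u :+ (q :* y :+ δ :* v))
      refl q δ (𝔼 m φ) (𝔼 m ψ) (φ (suc m)) (ψ (suc m)))

  𝔼-*ˡ : ∀ m c (φ : ℕ → ℚ) → 𝔼 m (λ a → c * φ a) ≡ c * 𝔼 m φ
  𝔼-*ˡ zero    c φ = refl
  𝔼-*ˡ (suc m) c φ = trans (cong (λ z → q * z + δ * (c * φ (suc m))) (𝔼-*ˡ m c φ))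
    (solve 5 (λ q δ c x u → q :* (c :* x) :+ δ :* (c :* u) := c :* (q :* x :+ δ :* u))
      refl q δ c (𝔼 m φ) (φ (suc m)))

  𝔼-swap : ∀ m l (φ : ℕ → ℕ → ℚ) → 𝔼 m (λ a → 𝔼 l (φ a)) ≡ 𝔼 l (λ b → 𝔼 m (λ a → φ a b))
  𝔼-swap zero    l φ = refl
  𝔼-swap (suc m) l φ = begin
    q * 𝔼 m (λ a → 𝔼 l (φ a)) + δ * 𝔼 l (φ (suc m))
      ≡⟨ cong (λ z → q * z + δ * 𝔼 l (φ (suc m))) (𝔼-swap m l φ) ⟩
    q * 𝔼 l (λ b → 𝔼 m (λ a → φ a b)) + δ * 𝔼 l (φ (suc m))
      ≡⟨ cong₂ _+_ (𝔼-*ˡ l q (λ b → 𝔼 m (λ a → φ a b))) (𝔼-*ˡ l δ (φ (suc m))) ⟨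
    𝔼 l (λ b → q * 𝔼 m (λ a → φ a b)) + 𝔼 l (λ b → δ * φ (suc m) b)
      ≡⟨ 𝔼-+ l _ _ ⟨
    𝔼 l (λ b → q * 𝔼 m (λ a → φ a b) + δ * φ (suc m) b) ∎
    where open ≡-Reasoning

  𝔼-∑ : ∀ m n (φ : ℕ → ℕ → ℚ) → 𝔼 m (λ a → ∑ n (φ a)) ≡ ∑ n (λ i → 𝔼 m (λ a → φ a i))
  𝔼-∑ m zero    φ = 𝔼-const m 0ℚ
  𝔼-∑ m (suc n) φ = trans (𝔼-+ m (λ a → ∑ n (φ a)) (λ a → φ a n))
    (cong (_+ 𝔼 m (λ a → φ a n)) (𝔼-∑ m n φ))

  𝔼-suc≥ : ∀ m {φ : ℕ → ℚ} → (∀ a → a ℕ.≤ suc m → 0ℚ ≤ φ a) → q * 𝔼 m φ ≤ 𝔼 (suc m) φ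
  𝔼-suc≥ m {φ} 0≤φ = ≤-by (δ * φ (suc m)) (0≤* 0≤δ (0≤φ (suc m) ℕₚ.≤-refl)) refl

  𝔼ⁿ : ℕ → ℕ → (List ℕ → ℚ) → ℚ
  𝔼ⁿ m zero    φ = φ []
  𝔼ⁿ m (suc k) φ = 𝔼 m (λ a → 𝔼ⁿ m k (λ p → φ (a ∷ p)))

  𝔼ⁿ-mono : ∀ m k {φ ψ : List ℕ → ℚ} →
    (∀ p → length p ≡ k → All (ℕ._≤ m) p → φ p ≤ ψ p) → 𝔼ⁿ m k φ ≤ 𝔼ⁿ m k ψ
  𝔼ⁿ-mono m zero    φ≤ψ = φ≤ψ [] refl []
  𝔼ⁿ-mono m (suc k) φ≤ψ = 𝔼-mono m (λ a a≤m →
    𝔼ⁿ-mono m k (λ p eq p≤m → φ≤ψ (a ∷ p) (cong suc eq) (a≤m ∷ p≤m)))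

  𝔼ⁿ-cong : ∀ m k {φ ψ : List ℕ → ℚ} → (∀ p → φ p ≡ ψ p) → 𝔼ⁿ m k φ ≡ 𝔼ⁿ m k ψ
  𝔼ⁿ-cong m zero    eq = eq []
  𝔼ⁿ-cong m (suc k) eq = 𝔼-cong m (λ a → 𝔼ⁿ-cong m k (λ p → eq (a ∷ p)))

  𝔼ⁿ-const : ∀ m k c → 𝔼ⁿ m k (λ _ → c) ≡ c
  𝔼ⁿ-const m zero    c = refl
  𝔼ⁿ-const m (suc k) c = trans (𝔼-cong m (λ _ → 𝔼ⁿ-const m k c)) (𝔼-const m c)

  𝔼ⁿ-+ : ∀ m k (φ ψ : List ℕ → ℚ) → 𝔼ⁿ m k (λ p → φ p + ψ p) ≡ 𝔼ⁿ m k φ + 𝔼ⁿ m k ψ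
  𝔼ⁿ-+ m zero    φ ψ = refl
  𝔼ⁿ-+ m (suc k) φ ψ = trans (𝔼-cong m (λ a → 𝔼ⁿ-+ m k (λ p → φ (a ∷ p)) (λ p → ψ (a ∷ p)))) (𝔼-+ m _ _)

  𝔼ⁿ-*ˡ : ∀ m k c (φ : List ℕ → ℚ) → 𝔼ⁿ m k (λ p → c * φ p) ≡ c * 𝔼ⁿ m k φ
  𝔼ⁿ-*ˡ m zero    c φ = refl
  𝔼ⁿ-*ˡ m (suc k) c φ = trans (𝔼-cong m (λ a → 𝔼ⁿ-*ˡ m k c (λ p → φ (a ∷ p)))) (𝔼-*ˡ m c _)

  𝔼ⁿ-snoc : ∀ m k (φ : List ℕ → ℚ) → 𝔼ⁿ m (suc k) φ ≡ 𝔼ⁿ m k (λ p → 𝔼 m (λ a → φ (p ++ [ a ])))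
  𝔼ⁿ-snoc m zero    φ = refl
  𝔼ⁿ-snoc m (suc k) φ = 𝔼-cong m (λ a → 𝔼ⁿ-snoc m k (λ p → φ (a ∷ p)))

  -- With probability q^k no draw is replaced by m + 1, and the law is then the one for m; the
  -- remaining cases contribute nonnegative terms.
  𝔼ⁿ-suc≥ : ∀ m k {φ : List ℕ → ℚ} → (∀ p → 0ℚ ≤ φ p) → pow q k * 𝔼ⁿ m k φ ≤ 𝔼ⁿ (suc m) k φ
  𝔼ⁿ-suc≥ m zero    {φ} 0≤φ = ≤-reflexive (*-identityˡ (φ []))
  𝔼ⁿ-suc≥ m (suc k) {φ} 0≤φ = begin
    q * pow q k * 𝔼 m (λ a → 𝔼ⁿ m k (λ p → φ (a ∷ p)))
      ≡⟨ trans (*-assoc q (pow q k) _) (cong (q *_) (sym (𝔼-*ˡ m (pow q k) _))) ⟩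
    q * 𝔼 m (λ a → pow q k * 𝔼ⁿ m k (λ p → φ (a ∷ p)))
      ≤⟨ *-monoˡ q 0≤q (𝔼-mono m (λ a _ → 𝔼ⁿ-suc≥ m k (λ p → 0≤φ (a ∷ p)))) ⟩
    q * 𝔼 m (λ a → 𝔼ⁿ (suc m) k (λ p → φ (a ∷ p)))
      ≤⟨ 𝔼-suc≥ m (λ a _ → subst (_≤ 𝔼ⁿ (suc m) k _) (𝔼ⁿ-const (suc m) k 0ℚ)
           (𝔼ⁿ-mono (suc m) k (λ p _ _ → 0≤φ (a ∷ p)))) ⟩
    𝔼 (suc m) (λ a → 𝔼ⁿ (suc m) k (λ p → φ (a ∷ p))) ∎
    where open ≤-Reasoning

  -- An independent draw inserted at any of the k + 1 positions yields k + 1 independent draws with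
  -- the same law, so all positions contribute equally.
  𝔼-insertAll : ∀ m k (ψ : List ℕ → ℚ) →
    𝔼 m (λ x → 𝔼ⁿ m k (λ p → sumOver (insertAll x p) ψ)) ≡ ι (suc k) * 𝔼ⁿ m (suc k) ψ
  𝔼-insertAll m zero ψ = trans (𝔼-cong m (λ x → +-identityʳ (ψ [ x ])))
    (solve 1 (λ y → y := (con 1ℚ :+ con 0ℚ) :* y) refl (𝔼 m (λ x → ψ [ x ])))
  𝔼-insertAll m (suc k) ψ = begin
    𝔼 m (λ x → 𝔼 m (λ y → 𝔼ⁿ m k (λ p → ψ (x ∷ y ∷ p) + sumOver (map (y ∷_) (insertAll x p)) ψ)))
      ≡⟨ 𝔼-cong m (λ x → 𝔼-cong m (λ y → trans (𝔼ⁿ-+ m k _ _)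
           (cong (𝔼ⁿ m k (λ p → ψ (x ∷ y ∷ p)) +_)
             (𝔼ⁿ-cong m k (λ p → sumOver-map (y ∷_) (insertAll x p) ψ))))) ⟩
    𝔼 m (λ x → 𝔼 m (λ y → 𝔼ⁿ m k (λ p → ψ (x ∷ y ∷ p)) + R x y))
      ≡⟨ trans (𝔼-cong m (λ x → 𝔼-+ m _ _)) (𝔼-+ m _ _) ⟩
    𝔼ⁿ m (suc (suc k)) ψ + 𝔼 m (λ x → 𝔼 m (R x))
      -- Averaging over the first entry y last exposes the induction hypothesis for the tail behind
      -- y.
      ≡⟨ cong (𝔼ⁿ m (suc (suc k)) ψ +_) (𝔼-swap m m R) ⟩
    𝔼ⁿ m (suc (suc k)) ψ + 𝔼 m (λ y → 𝔼 m (λ x → R x y))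
      ≡⟨ cong (𝔼ⁿ m (suc (suc k)) ψ +_)
           (trans (𝔼-cong m (λ y → 𝔼-insertAll m k (ψ ∘ (y ∷_)))) (𝔼-*ˡ m (ι (suc k)) _)) ⟩
    𝔼ⁿ m (suc (suc k)) ψ + ι (suc k) * 𝔼ⁿ m (suc (suc k)) ψ
      ≡⟨ solve 2 (λ y n → y :+ n :* y := (con 1ℚ :+ n) :* y) refl (𝔼ⁿ m (suc (suc k)) ψ) (ι (suc k)) ⟩
    ι (suc (suc k)) * 𝔼ⁿ m (suc (suc k)) ψ ∎
    where
    open ≡-Reasoning
    R : ℕ → ℕ → ℚ
    R x y = 𝔼ⁿ m k (λ p → sumOver (insertAll x p) (ψ ∘ (y ∷_)))

  -- Exchangeability: independent draws have the same law in each of the k! orders.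
  𝔼ⁿ-perms : ∀ m k (ψ : List ℕ → ℚ) → 𝔼ⁿ m k (λ p → sumOver (perms p) ψ) ≡ ι (k !) * 𝔼ⁿ m k ψ
  𝔼ⁿ-perms m zero    ψ = solve 1 (λ y → y :+ con 0ℚ := (con 1ℚ :+ con 0ℚ) :* y) refl (ψ [])
  𝔼ⁿ-perms m (suc k) ψ = begin
    𝔼 m (λ x → 𝔼ⁿ m k (λ p → sumOver (concatMap (insertAll x) (perms p)) ψ))
      ≡⟨ 𝔼-cong m (λ x → 𝔼ⁿ-cong m k (λ p → sumOver-concatMap (insertAll x) (perms p) ψ)) ⟩
    𝔼 m (λ x → 𝔼ⁿ m k (λ p → sumOver (perms p) (λ r → sumOver (insertAll x r) ψ)))
      ≡⟨ 𝔼-cong m (λ x → 𝔼ⁿ-perms m k (λ r → sumOver (insertAll x r) ψ)) ⟩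
    𝔼 m (λ x → ι (k !) * 𝔼ⁿ m k (λ p → sumOver (insertAll x p) ψ))
      ≡⟨ 𝔼-*ˡ m (ι (k !)) _ ⟩
    ι (k !) * 𝔼 m (λ x → 𝔼ⁿ m k (λ p → sumOver (insertAll x p) ψ))
      ≡⟨ cong (ι (k !) *_) (𝔼-insertAll m k ψ) ⟩
    ι (k !) * (ι (suc k) * 𝔼ⁿ m (suc k) ψ)
      ≡⟨ trans (solve 3 (λ f n y → f :* (n :* y) := n :* f :* y) refl (ι (k !)) (ι (suc k)) (𝔼ⁿ m (suc k) ψ))
           (cong (_* 𝔼ⁿ m (suc k) ψ) (sym (ι-* (suc k) (k !)))) ⟩
    ι (suc k !) * 𝔼ⁿ m (suc k) ψ ∎
    where open ≡-Reasoning

-- The algorithm on items of unit size.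

-- The goal of run≡packFrom, once the initial capacity and history are abstracted, solves the
-- metavariable by the loop local to run, which has no name outside Defs.
mutual
  packFrom : ∀ {n} → Algorithm → Instance n → ℚ → List (ℚ × ℚ) → List (Fin n) → ℚ
  packFrom A I rem hist js = _

  run≡packFrom : ∀ {n} (A : Algorithm) (I : Instance n) js → run A I js ≡ packFrom A I (Instance.C I) [] js
  run≡packFrom A I js with Instance.C I | (List (ℚ × ℚ) ∋ [])
  ... | rem | hist = refl

unitSizes : ∀ κ → 1ℚ ≤ κ → (p : List ℕ) → Instance (length p)
unitSizes κ 1≤κ p = record
  { C = 1ℚ ; v = pow κ ∘ lookup p ; s = λ _ → 1ℚ
  ; C>0 = positive⁻¹ 1ℚ ; v>0 = 0<pow 1≤κ ∘ lookup p ; s>0 = λ _ → positive⁻¹ 1ℚ }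

State : Set
State = ℚ × List (ℚ × ℚ)

module Play (A : Algorithm) (n : ℕ) (κ : ℚ) (1≤κ : 1ℚ ≤ κ) where

  V : ℕ → ℚ
  V = pow κ

  0<V : ∀ a → 0ℚ < V a
  0<V = 0<pow 1≤κ

  V-mono : ∀ {a b} → a ℕ.≤ b → V a ≤ V b
  V-mono = pow-monoʳ 1≤κ

  -- The factor `1ℚ *` is the item size in `run`; keeping it makes the two loops agree by
  -- computation.
  fraction : State → ℕ → ℚ
  fraction (rem , hist) a =
    if (0ℚ ≤ᵇ o) ∧ (o ≤ᵇ 1ℚ) ∧ (1ℚ * o ≤ᵇ rem) then o else 0ℚ
    where o = A n 1ℚ hist (V a , 1ℚ)

  step : State → ℕ → State
  step (rem , hist) a = rem - 1ℚ * fraction (rem , hist) a , hist ++ [ (V a , 1ℚ) ]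

  play : State → List ℕ → ℚ
  play st []       = 0ℚ
  play st (a ∷ as) = V a * fraction st a + play (step st a) as

  initial : State
  initial = 1ℚ , []

  after : List ℕ → State
  after = foldl step initial

  after-snoc : ∀ p a → after (p ++ [ a ]) ≡ step (after p) a
  after-snoc p a = foldl-++ step initial p [ a ]

  if-bounds : ∀ o rem → 0ℚ ≤ rem →
    let x = if (0ℚ ≤ᵇ o) ∧ (o ≤ᵇ 1ℚ) ∧ (1ℚ * o ≤ᵇ rem) then o else 0ℚ in 0ℚ ≤ x × x ≤ rem
  if-bounds o rem 0≤rem with 0ℚ ≤ᵇ o in p | o ≤ᵇ 1ℚ | 1ℚ * o ≤ᵇ rem in r
  ... | true  | true  | true  = ≤ᵇ⇒≤ (subst T (sym p) tt) ,
    subst (_≤ rem) (*-identityˡ o) (≤ᵇ⇒≤ (subst T (sym r) tt))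
  ... | true  | true  | false = ≤-refl , 0≤rem
  ... | true  | false | _     = ≤-refl , 0≤rem
  ... | false | _     | _     = ≤-refl , 0≤rem

  fraction-bounds : ∀ st a → 0ℚ ≤ proj₁ st → 0ℚ ≤ fraction st a × fraction st a ≤ proj₁ st
  fraction-bounds (rem , hist) a = if-bounds (A n 1ℚ hist (V a , 1ℚ)) rem

  remaining-step : ∀ st a → proj₁ (step st a) ≡ proj₁ st - fraction st a
  remaining-step st a = cong (λ z → proj₁ st - z) (*-identityˡ (fraction st a))

  0≤remaining-step : ∀ st a → 0ℚ ≤ proj₁ st → 0ℚ ≤ proj₁ (step st a)
  0≤remaining-step st a 0≤rem = subst (0ℚ ≤_) (sym (remaining-step st a))
    (0≤-gap (proj₂ (fraction-bounds st a 0≤rem)))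

  0≤remaining : ∀ st p → 0ℚ ≤ proj₁ st → 0ℚ ≤ proj₁ (foldl step st p)
  0≤remaining st []      0≤rem = 0≤rem
  0≤remaining st (a ∷ p) 0≤rem = 0≤remaining (step st a) p (0≤remaining-step st a 0≤rem)

  fraction-after : ∀ p a → 0ℚ ≤ fraction (after p) a × fraction (after p) a ≤ proj₁ (after p)
  fraction-after p a = fraction-bounds (after p) a (0≤remaining initial p 0≤1)

  -- A full unit of capacity earns at most `V m`, and the fractions packed add up to at most the
  -- remaining capacity.
  play≤ : ∀ m st p → All (ℕ._≤ m) p → 0ℚ ≤ proj₁ st → play st p ≤ V m * proj₁ st
  play≤ m st []      []          0≤rem = 0≤* (<⇒≤ (0<V m)) 0≤rem
  play≤ m st (a ∷ p) (a≤m ∷ p≤m) 0≤rem = begin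
    V a * x + play (step st a) p
      ≤⟨ +-mono-≤ (*-monoʳ x (proj₁ (fraction-bounds st a 0≤rem)) (V-mono a≤m))
                  (play≤ m (step st a) p p≤m (0≤remaining-step st a 0≤rem)) ⟩
    V m * x + V m * proj₁ (step st a)
      ≡⟨ cong (λ z → V m * x + V m * z) (remaining-step st a) ⟩
    V m * x + V m * (proj₁ st - x)
      ≡⟨ solve 3 (λ v x r → v :* x :+ v :* (r :- x) := v :* r) refl (V m) x (proj₁ st) ⟩
    V m * proj₁ st ∎
    where
    open ≤-Reasoning
    x = fraction st a

  -- Sums, over all positions where `a` can be inserted into the list, the fraction that `a` would
  -- get there.
  offers : ℕ → State → List ℕ → ℚ
  offers a st []      = fraction st a
  offers a st (b ∷ p) = fraction st a + offers a (step st b) p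

  -- In each of the `suc (length p)` insertions the items other than the top one earn together at
  -- most `V m` times the capacity.
  play-insertAll : ∀ m st p → All (ℕ._≤ m) p → 0ℚ ≤ proj₁ st →
    sumOver (insertAll (suc m) p) (play st) ≤ V (suc m) * offers (suc m) st p + ι (suc (length p)) * (V m * proj₁ st)
  play-insertAll m st [] [] 0≤rem = ≤-by (V m * proj₁ st) (0≤* (<⇒≤ (0<V m)) 0≤rem)
    (solve 3 (λ v x w → v :* x :+ con 0ℚ :+ con 0ℚ :+ w := v :* x :+ (con 1ℚ :+ con 0ℚ) :* w)
      refl (V (suc m)) (fraction st (suc m)) (V m * proj₁ st))
  play-insertAll m st (b ∷ p) (b≤m ∷ p≤m) 0≤rem = begin
    V M * x + play (step st M) (b ∷ p) + sumOver (map (b ∷_) (insertAll M p)) (play st)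
      ≡⟨ cong (V M * x + play (step st M) (b ∷ p) +_)
           (trans (sumOver-map (b ∷_) (insertAll M p) (play st))
             (trans (sumOver-shift (insertAll M p) (V b * y) (play (step st b)))
               (cong (λ l → ι l * (V b * y) + S) (length-insertAll M p)))) ⟩
    V M * x + play (step st M) (b ∷ p) + (ι (suc l) * (V b * y) + S)
      ≤⟨ +-mono-≤ (+-monoʳ-≤ (V M * x) rest≤)
           (+-mono-≤ (*-monoˡ (ι (suc l)) (0≤ι (suc l))
                       (*-monoʳ y (proj₁ (fraction-bounds st b 0≤rem)) (V-mono b≤m)))
                     (play-insertAll m (step st b) p p≤m (0≤remaining-step st b 0≤rem))) ⟩
    V M * x + V m * r + (ι (suc l) * (V m * y) + (V M * G + ι (suc l) * (V m * proj₁ (step st b))))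
      ≡⟨ cong (λ z → V M * x + V m * r + (ι (suc l) * (V m * y) + (V M * G + ι (suc l) * (V m * z))))
           (remaining-step st b) ⟩
    V M * x + V m * r + (ι (suc l) * (V m * y) + (V M * G + ι (suc l) * (V m * (r - y))))
      ≡⟨ solve 7 (λ vM x vm r y G l →
           vM :* x :+ vm :* r :+ (l :* (vm :* y) :+ (vM :* G :+ l :* (vm :* (r :- y))))
             := vM :* (x :+ G) :+ (con 1ℚ :+ l) :* (vm :* r))
           refl (V M) x (V m) r y G (ι (suc l)) ⟩
    V M * (x + G) + ι (suc (suc l)) * (V m * r) ∎
    where
    open ≤-Reasoning
    M = suc m
    l = length p
    r = proj₁ st
    x = fraction st M
    y = fraction st b
    S = sumOver (insertAll M p) (play (step st b))
    G = offers M (step st b) p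

    rest≤ : play (step st M) (b ∷ p) ≤ V m * r
    rest≤ = ≤-trans (play≤ m (step st M) (b ∷ p) (b≤m ∷ p≤m) (0≤remaining-step st M 0≤rem))
      (*-monoˡ (V m) (<⇒≤ (0<V m))
        (≤-by x (proj₁ (fraction-bounds st M 0≤rem))
          (trans (cong (_+ x) (remaining-step st M)) (solve 2 (λ r x → r :- x :+ x := r) refl r x))))

  -- Average fractions and their recursion in m.

  module Averages (q δ : ℚ) (0≤q : 0ℚ ≤ q) (0≤δ : 0ℚ ≤ δ) (q+δ≡1 : q + δ ≡ 1ℚ) where
    open Draws q δ 0≤q 0≤δ q+δ≡1

    -- `onMaximum j m` and `onAny j m` are the quantities h j m and d j m of the outline.
    onMaximum : ℕ → ℕ → ℚ
    onMaximum j m = 𝔼ⁿ m j (λ p → fraction (after p) (suc m))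

    onAny : ℕ → ℕ → ℚ
    onAny j m = 𝔼ⁿ m j (λ p → 𝔼 m (fraction (after p)))

    -- The fraction given to the top item at position i depends only on the i draws before it, so
    -- the later draws integrate out.
    𝔼ⁿ-offers : ∀ m k st → 𝔼ⁿ m k (offers (suc m) st) ≡
      ∑ (suc k) (λ i → 𝔼ⁿ m i (λ p → fraction (foldl step st p) (suc m)))
    𝔼ⁿ-offers m zero    st = sym (+-identityˡ (fraction st (suc m)))
    𝔼ⁿ-offers m (suc k) st = begin
      𝔼 m (λ b → 𝔼ⁿ m k (λ p → x + offers (suc m) (step st b) p))
        ≡⟨ 𝔼-cong m (λ b → trans (𝔼ⁿ-+ m k (λ _ → x) (offers (suc m) (step st b)))
             (cong₂ _+_ (𝔼ⁿ-const m k x) (𝔼ⁿ-offers m k (step st b)))) ⟩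
      𝔼 m (λ b → x + ∑ (suc k) (λ i → 𝔼ⁿ m i (λ p → fraction (foldl step (step st b) p) (suc m))))
        ≡⟨ trans (𝔼-+ m (λ _ → x) _) (cong₂ _+_ (𝔼-const m x) (𝔼-∑ m (suc k) _)) ⟩
      x + ∑ (suc k) (λ i → 𝔼ⁿ m (suc i) (λ p → fraction (foldl step st p) (suc m)))
        ≡⟨ ∑-head (suc k) (λ i → 𝔼ⁿ m i (λ p → fraction (foldl step st p) (suc m))) ⟨
      ∑ (suc (suc k)) (λ i → 𝔼ⁿ m i (λ p → fraction (foldl step st p) (suc m))) ∎
      where
      open ≡-Reasoning
      x = fraction st (suc m)

    -- Conservation of capacity: each draw lowers the remainder by exactly the fraction it receives.
    remaining-average : ∀ m j → 𝔼ⁿ m j (λ p → proj₁ (after p)) + ∑ j (λ i → onAny i m) ≡ 1ℚ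
    remaining-average m zero    = refl
    remaining-average m (suc j) = begin
      𝔼ⁿ m (suc j) rem + (D + d)
        ≡⟨ cong (_+ (D + d)) (trans (𝔼ⁿ-snoc m j rem) (𝔼ⁿ-cong m j (λ p → 𝔼-cong m (λ a →
             trans (cong proj₁ (after-snoc p a)) (trans (remaining-step (after p) a)
               (solve 2 (λ r x → r :- x := r :+ con (- 1ℚ) :* x) refl (rem p) (fraction (after p) a))))))) ⟩
      𝔼ⁿ m j (λ p → 𝔼 m (λ a → rem p + - 1ℚ * fraction (after p) a)) + (D + d)
        ≡⟨ cong (_+ (D + d)) (trans
             (𝔼ⁿ-cong m j (λ p → trans (𝔼-+ m (λ _ → rem p) _)
               (cong₂ _+_ (𝔼-const m (rem p)) (𝔼-*ˡ m (- 1ℚ) (fraction (after p))))))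
             (trans (𝔼ⁿ-+ m j rem _) (cong (𝔼ⁿ m j rem +_) (𝔼ⁿ-*ˡ m j (- 1ℚ) _)))) ⟩
      𝔼ⁿ m j rem + - 1ℚ * d + (D + d)
        ≡⟨ solve 3 (λ r d D → r :+ con (- 1ℚ) :* d :+ (D :+ d) := r :+ D) refl (𝔼ⁿ m j rem) d D ⟩
      𝔼ⁿ m j rem + D
        ≡⟨ remaining-average m j ⟩
      1ℚ ∎
      where
      open ≡-Reasoning
      rem : List ℕ → ℚ
      rem p = proj₁ (after p)
      D = ∑ j (λ i → onAny i m)
      d = onAny j m

    0≤onMaximum : ∀ j m → 0ℚ ≤ onMaximum j m
    0≤onMaximum j m = subst (_≤ onMaximum j m) (𝔼ⁿ-const m j 0ℚ)
      (𝔼ⁿ-mono m j (λ p _ _ → proj₁ (fraction-after p (suc m))))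

    0≤𝔼-fraction : ∀ m p → 0ℚ ≤ 𝔼 m (fraction (after p))
    0≤𝔼-fraction m p = subst (_≤ 𝔼 m (fraction (after p))) (𝔼-const m 0ℚ)
      (𝔼-mono m (λ a _ → proj₁ (fraction-after p a)))

    0≤onAny : ∀ j m → 0ℚ ≤ onAny j m
    0≤onAny j m = subst (_≤ onAny j m) (𝔼ⁿ-const m j 0ℚ) (𝔼ⁿ-mono m j (λ p _ _ → 0≤𝔼-fraction m p))

    onMaximum-budget : ∀ j m → onMaximum j m + ∑ j (λ i → onAny i m) ≤ 1ℚ
    onMaximum-budget j m = ≤-trans
      (+-monoˡ-≤ (∑ j (λ i → onAny i m)) (𝔼ⁿ-mono m j (λ p _ _ → proj₂ (fraction-after p (suc m)))))
      (≤-reflexive (remaining-average m j))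

    onAny≤1 : ∀ j m → onAny j m ≤ 1ℚ
    onAny≤1 j m = ≤-trans (≤-by (onMaximum (suc j) m + ∑ j (λ i → onAny i m))
        (0≤+ (0≤onMaximum (suc j) m) (0≤∑ j (λ i → 0≤onAny i m)))
        (solve 3 (λ d h D → d :+ (h :+ D) := h :+ (D :+ d)) refl (onAny j m) (onMaximum (suc j) m) (∑ j (λ i → onAny i m))))
      (onMaximum-budget (suc j) m)

    -- Of the j+1 draws below m+2, none equals m+1 with probability q^(j+1), and only the last one
    -- does with probability δ q^j.
    onAny-suc≥ : ∀ j m → q * pow q j * onAny j m + δ * pow q j * onMaximum j m ≤ onAny j (suc m)
    onAny-suc≥ j m = ≤-trans (≤-reflexive eq) (𝔼ⁿ-suc≥ m j (λ p → 0≤𝔼-fraction (suc m) p))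
      where
      eq : q * pow q j * onAny j m + δ * pow q j * onMaximum j m
         ≡ pow q j * 𝔼ⁿ m j (λ p → 𝔼 (suc m) (fraction (after p)))
      eq = trans (solve 5 (λ q w d δ h → q :* w :* d :+ δ :* w :* h := w :* (q :* d :+ δ :* h))
                   refl q (pow q j) (onAny j m) δ (onMaximum j m))
        (cong (pow q j *_) (sym (trans (𝔼ⁿ-+ m j _ _) (cong₂ _+_ (𝔼ⁿ-*ˡ m j q _) (𝔼ⁿ-*ˡ m j δ _)))))

-- From the random-order model to lists of exponents.

packFrom≡play : ∀ A κ (1≤κ : 1ℚ ≤ κ) p rem hist js →
  packFrom A (unitSizes κ 1≤κ p) rem hist js
    ≡ Play.play A (length p) κ 1≤κ (rem , hist) (map (lookup p) js)
packFrom≡play A κ 1≤κ p rem hist []       = refl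
packFrom≡play A κ 1≤κ p rem hist (j ∷ js) =
  cong (pow κ (lookup p j) * fraction st (lookup p j) +_)
    (packFrom≡play A κ 1≤κ p (proj₁ st′) (proj₂ st′) js)
  where
  open Play A (length p) κ 1≤κ
  st = rem , hist
  st′ = step st (lookup p j)

expectedValue≡play : ∀ A κ (1≤κ : 1ℚ ≤ κ) p → let open Play A (length p) κ 1≤κ in
  expectedValue A (unitSizes κ 1≤κ p) ≡ sumOver (perms p) (play initial) * invFact (length p)
expectedValue≡play A κ 1≤κ p = cong (_* invFact (length p)) (begin
  sumOver (perms (allFin (length p))) (run A I)
    ≡⟨ sumOver-cong (perms (allFin (length p))) (λ js →
         trans (run≡packFrom A I js) (packFrom≡play A κ 1≤κ p 1ℚ [] js)) ⟩
  sumOver (perms (allFin (length p))) (play initial ∘ map (lookup p))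
    ≡⟨ sumOver-map (map (lookup p)) (perms (allFin (length p))) (play initial) ⟨
  sumOver (map (map (lookup p)) (perms (allFin (length p)))) (play initial)
    ≡⟨ cong (λ l → sumOver l (play initial)) (perms-map (lookup p) (allFin (length p))) ⟨
  sumOver (perms (map (lookup p) (allFin (length p)))) (play initial)
    ≡⟨ cong (λ l → sumOver (perms l) (play initial)) (trans (map-tabulate (λ j → j) (lookup p)) (tabulate-lookup p)) ⟩
  sumOver (perms p) (play initial) ∎)
  where
  open ≡-Reasoning
  open Play A (length p) κ 1≤κ
  I = unitSizes κ 1≤κ p

-- The solution to compete with: index 0 will hold the most valuable item, which alone fills the
-- knapsack.
onlyFirst : ∀ {l} → Fin (suc l) → ℚ
onlyFirst zero    = 1ℚ
onlyFirst (suc _) = 0ℚ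

Σ-onlyFirst : ∀ {l} (w : Fin (suc l) → ℚ) → Σ[ suc l ] (λ j → w j * onlyFirst j) ≡ w zero
Σ-onlyFirst {l} w = trans (cong₂ _+_ (*-identityʳ (w zero)) (vanish l suc (λ j → *-zeroʳ (w (suc j)))))
  (+-identityʳ (w zero))
  where
  vanish : ∀ i (g : Fin i → Fin (suc l)) {φ : Fin (suc l) → ℚ} → (∀ j → φ (g j) ≡ 0ℚ) → sumOver (tabulate g) φ ≡ 0ℚ
  vanish zero    g eq = refl
  vanish (suc i) g eq = cong₂ _+_ (eq zero) (vanish i (g ∘ suc) (eq ∘ suc))

onlyFirst-feasible : ∀ κ (1≤κ : 1ℚ ≤ κ) a p → Feasible (unitSizes κ 1≤κ (a ∷ p)) onlyFirst
onlyFirst-feasible κ 1≤κ a p =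
  (λ { zero → 0≤1 ; (suc _) → ≤-refl }) ,
  (λ { zero → ≤-refl ; (suc _) → 0≤1 }) ,
  ≤-reflexive (Σ-onlyFirst {length p} (λ _ → 1ℚ))

-- Consequences of competitiveness and sums over m < l.

module Accumulated (A : Algorithm) (n : ℕ) (κ : ℚ) (1≤κ : 1ℚ ≤ κ)
  (q δ : ℚ) (0≤q : 0ℚ ≤ q) (0≤δ : 0ℚ ≤ δ) (q+δ≡1 : q + δ ≡ 1ℚ)
  where

  open Play A n κ 1≤κ
  open Averages q δ 0≤q 0≤δ q+δ≡1
  open Draws q δ 0≤q 0≤δ q+δ≡1

  -- Average the competitive bound over the k items beside the top one. By exchangeability only the
  -- position of the top item matters; the other items earn at most `V m`, which is r `V M`, in each
  -- of the n positions.
  competitive⇒onMaximum : ∀ k β r m → n ≡ suc k → κ * r ≡ 1ℚ →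
    (∀ (I : Instance n) x → Feasible I x → β * value I x ≤ expectedValue A I) →
    ι n * (β - r) ≤ ∑ n (λ i → onMaximum i m)
  competitive⇒onMaximum k β r m refl κr≡1 competitive =
    *-cancelˡ-≤-pos (V M) {{positive (0<V M)}} (begin
      V M * (ι n * (β - r))
        ≡⟨ solve 4 (λ v n β r → v :* (n :* (β :- r)) := n :* (β :* v) :- n :* (r :* v)) refl (V M) (ι n) β r ⟩
      ι n * (β * V M) - ι n * (r * V M)
        ≤⟨ +-mono-≤ (*-monoˡ (ι n) (0≤ι n) average≥) (≤-reflexive (cong (λ z → - (ι n * z)) rV≡V)) ⟩
      ι n * (ι (k !) * B * invFact n) - ι n * V m
        ≡⟨ cong (_- ι n * V m) (trans
             (solve 4 (λ n f B c → n :* (f :* B :* c) := n :* f :* c :* B) refl (ι n) (ι (k !)) B (invFact n))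
             (trans (cong (λ z → z * invFact n * B) (sym (ι-* n (k !))))
               (trans (cong (_* B) (ι-invFact n)) (*-identityˡ B)))) ⟩
      B - ι n * V m
        ≡⟨ solve 3 (λ x n v → x :+ n :* (v :* con 1ℚ) :- n :* v := x) refl (V M * G) (ι n) (V m) ⟩
      V M * G ∎)
    where
    open ≤-Reasoning
    M = suc m
    G = ∑ n (λ i → onMaximum i m)
    B = V M * G + ι n * (V m * 1ℚ)

    rV≡V : r * V M ≡ V m
    rV≡V = trans (solve 3 (λ r κ v → r :* (κ :* v) := κ :* r :* v) refl r κ (V m))
      (trans (cong (_* V m) κr≡1) (*-identityˡ (V m)))

    single : ∀ p → length p ≡ k → β * V M ≤ invFact n * sumOver (perms (M ∷ p)) (play initial)
    single p refl = subst₂ _≤_ (cong (β *_) (Σ-onlyFirst (V ∘ lookup (M ∷ p))))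
      (trans (expectedValue≡play A κ 1≤κ (M ∷ p)) (*-comm _ (invFact n)))
      (competitive (unitSizes κ 1≤κ (M ∷ p)) onlyFirst (onlyFirst-feasible κ 1≤κ M p))

    average≥ : β * V M ≤ ι (k !) * B * invFact n
    average≥ = begin
      β * V M
        ≡⟨ 𝔼ⁿ-const m k (β * V M) ⟨
      𝔼ⁿ m k (λ _ → β * V M)
        ≤⟨ 𝔼ⁿ-mono m k (λ p eq _ → single p eq) ⟩
      𝔼ⁿ m k (λ p → invFact n * sumOver (perms (M ∷ p)) (play initial))
        ≡⟨ 𝔼ⁿ-*ˡ m k (invFact n) _ ⟩
      invFact n * 𝔼ⁿ m k (λ p → sumOver (perms (M ∷ p)) (play initial))
        -- `perms (M ∷ p)` inserts `M` into each permutation of `p`, so exchangeability applies to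
        -- the draws alone.
        ≡⟨ cong (invFact n *_) (trans
             (𝔼ⁿ-cong m k (λ p → sumOver-concatMap (insertAll M) (perms p) (play initial)))
             (𝔼ⁿ-perms m k (λ p → sumOver (insertAll M p) (play initial)))) ⟩
      invFact n * (ι (k !) * 𝔼ⁿ m k (λ p → sumOver (insertAll M p) (play initial)))
        ≤⟨ *-monoˡ (invFact n) (0≤invFact n) (*-monoˡ (ι (k !)) (0≤ι (k !))
             (𝔼ⁿ-mono m k (λ { p refl p≤m → play-insertAll m initial p p≤m 0≤1 }))) ⟩
      invFact n * (ι (k !) * 𝔼ⁿ m k (λ p → V M * offers M initial p + ι (suc (length p)) * (V m * 1ℚ)))
        ≤⟨ *-monoˡ (invFact n) (0≤invFact n) (*-monoˡ (ι (k !)) (0≤ι (k !))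
             (𝔼ⁿ-mono m k (λ { p refl _ → ≤-refl }))) ⟩
      invFact n * (ι (k !) * 𝔼ⁿ m k (λ p → V M * offers M initial p + ι n * (V m * 1ℚ)))
        ≡⟨ cong (λ z → invFact n * (ι (k !) * z)) (trans (𝔼ⁿ-+ m k _ _) (cong₂ _+_
             (trans (𝔼ⁿ-*ˡ m k (V M) _) (cong (V M *_) (𝔼ⁿ-offers m k initial)))
             (𝔼ⁿ-const m k _))) ⟩
      invFact n * (ι (k !) * B)
        ≡⟨ *-comm (invFact n) _ ⟩
      ι (k !) * B * invFact n ∎

  module _ (l : ℕ) where

    totalOnMaximum : ℕ → ℚ
    totalOnMaximum j = ∑ l (onMaximum j)

    totalOnAny : ℕ → ℚ
    totalOnAny j = ∑ l (onAny j)

    total-budget : ∀ j → totalOnMaximum j + ∑ j totalOnAny ≤ ι l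
    total-budget j = begin
      totalOnMaximum j + ∑ j totalOnAny
        ≡⟨ cong (totalOnMaximum j +_) (∑-swap j l onAny) ⟩
      totalOnMaximum j + ∑ l (λ m → ∑ j (λ i → onAny i m))
        ≡⟨ ∑-+ l _ _ ⟨
      ∑ l (λ m → onMaximum j m + ∑ j (λ i → onAny i m))
        ≤⟨ ∑-mono l (λ m _ → onMaximum-budget j m) ⟩
      ∑ l (λ _ → 1ℚ)
        ≡⟨ trans (∑-const l 1ℚ) (*-identityʳ (ι l)) ⟩
      ι l ∎
      where open ≤-Reasoning

    totalOnMaximum≤ : ∀ j → totalOnMaximum j ≤ ι l
    totalOnMaximum≤ j = ≤-trans (≤-by (∑ j totalOnAny) (0≤∑ j (λ i → 0≤∑ l (0≤onAny i))) refl) (total-budget j)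

    -- Sum the recursion `onAny-suc≥` over m < l: shifting m by one changes the sum only at the two
    -- ends, by at most 1.
    telescoped : ∀ j → q * pow q j * totalOnAny j + δ * pow q j * totalOnMaximum j ≤ totalOnAny j + 1ℚ
    telescoped j = begin
      q * w * D + δ * w * H
        ≡⟨ trans (cong₂ _+_ (sym (∑-*ˡ l (q * w) _)) (sym (∑-*ˡ l (δ * w) _))) (sym (∑-+ l _ _)) ⟩
      ∑ l (λ m → q * w * onAny j m + δ * w * onMaximum j m)
        ≤⟨ ∑-mono l (λ m _ → onAny-suc≥ j m) ⟩
      ∑ l (λ m → onAny j (suc m))
        ≤⟨ ≤-by (onAny j 0) (0≤onAny j 0) (trans (+-comm _ (onAny j 0)) (sym (∑-head l (onAny j)))) ⟩
      D + onAny j l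
        ≤⟨ +-monoʳ-≤ D (onAny≤1 j l) ⟩
      D + 1ℚ ∎
      where
      open ≤-Reasoning
      w = pow q j
      H = totalOnMaximum j
      D = totalOnAny j

    -- By `telescoped`, δ q^j H ≤ (1 - q^(j+1)) D + 1. Bernoulli gives 1 - q^(j+1) ≤ (j+1) δ and q^j
    -- ≥ 1 - j δ; the loss j δ² H is at most n δ² l, and division by δ leaves the stated error.
    total-comparison : ∀ ρ → 0ℚ ≤ ρ → ρ * δ ≡ 1ℚ → ∀ j → j ℕ.≤ n →
      totalOnMaximum j ≤ ι (suc j) * totalOnAny j + (ρ + ι n * δ * ι l)
    total-comparison ρ 0≤ρ ρδ≡1 j j≤n = begin
      H
        ≡⟨ trans (cong (_* H) ρδ≡1) (*-identityˡ H) ⟨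
      ρ * δ * H
        ≡⟨ *-assoc ρ δ H ⟩
      ρ * (δ * H)
        ≤⟨ *-monoˡ ρ 0≤ρ δH≤ ⟩
      ρ * (δ * (ι (suc j) * D) + 1ℚ + δ * (ι n * δ * L))
        ≡⟨ solve 6 (λ ρ δ j D n L → ρ :* (δ :* (j :* D) :+ con 1ℚ :+ δ :* (n :* δ :* L))
             := ρ :* δ :* (j :* D) :+ (ρ :+ ρ :* δ :* (n :* δ :* L))) refl ρ δ (ι (suc j)) D (ι n) L ⟩
      ρ * δ * (ι (suc j) * D) + (ρ + ρ * δ * (ι n * δ * L))
        ≡⟨ cong₂ (λ x y → x + (ρ + y))
             (trans (cong (_* (ι (suc j) * D)) ρδ≡1) (*-identityˡ (ι (suc j) * D)))
             (trans (cong (_* (ι n * δ * L)) ρδ≡1) (*-identityˡ (ι n * δ * L))) ⟩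
      ι (suc j) * D + (ρ + ι n * δ * L) ∎
      where
      open ≤-Reasoning
      w = pow q j
      H = totalOnMaximum j
      D = totalOnAny j
      L = ι l
      J = ι j
      0≤D = 0≤∑ l (0≤onAny j)
      0≤H = 0≤∑ l (0≤onMaximum j)

      δH≤ : δ * H ≤ δ * (ι (suc j) * D) + 1ℚ + δ * (ι n * δ * L)
      δH≤ = ≤-by
        ((pow q j + J * δ - 1ℚ) * (δ * H) + (D + 1ℚ - (q * w * D + δ * w * H))
          + (q * w + ι (suc j) * δ - 1ℚ) * D + δ * δ * ((ι n - J) * L + J * (L - H)))
        (0≤+ (0≤+ (0≤+ (0≤* (0≤-gap (bernoulli 0≤q 0≤δ q+δ≡1 j)) (0≤* 0≤δ 0≤H))
                       (0≤-gap (telescoped j)))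
                  (0≤* (0≤-gap (bernoulli 0≤q 0≤δ q+δ≡1 (suc j))) 0≤D))
             (0≤* (0≤* 0≤δ 0≤δ) (0≤+ (0≤* (0≤-gap (ι-mono j≤n)) (0≤ι l))
                                     (0≤* (0≤ι j) (0≤-gap (totalOnMaximum≤ j))))))
        (solve 8 (λ δ H D J w q n L →
          δ :* H :+ ((w :+ J :* δ :- con 1ℚ) :* (δ :* H) :+ (D :+ con 1ℚ :- (q :* w :* D :+ δ :* w :* H))
            :+ (q :* w :+ (con 1ℚ :+ J) :* δ :- con 1ℚ) :* D :+ δ :* δ :* ((n :- J) :* L :+ J :* (L :- H)))
          := δ :* ((con 1ℚ :+ J) :* D) :+ con 1ℚ :+ δ :* (n :* δ :* L))
          refl δ H D J w q (ι n) L)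

    total-≥ : ∀ b → (∀ m → b ≤ ∑ n (λ i → onMaximum i m)) → ι l * b ≤ ∑ n totalOnMaximum
    total-≥ b b≤ = begin
      ι l * b                                 ≡⟨ ∑-const l b ⟨
      ∑ l (λ _ → b)                           ≤⟨ ∑-mono l (λ m _ → b≤ m) ⟩
      ∑ l (λ m → ∑ n (λ i → onMaximum i m))   ≡⟨ ∑-swap l n (λ m i → onMaximum i m) ⟩
      ∑ n totalOnMaximum                      ∎
      where open ≤-Reasoning

-- Choice of the parameters and the contradiction.

theorem4p3 : (α : ℚ) → invE< α → (A : Algorithm) → ¬ Competitive α A
theorem4p3 α (k , 1<αe) A (f , f→0 , competitive) = <-irrefl refl (<-≤-trans (positive⁻¹ 1ℚ) (≤-trans 1≤τ τ≤0))
  where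
  2ℚ = 1ℚ + 1ℚ
  3ℚ = 1ℚ + 2ℚ
  6ℚ = 3ℚ + 3ℚ
  τ = texp k 1ℚ

  1≤τ : 1ℚ ≤ τ
  1≤τ = 1≤texp k 0≤1

  0≤τ : 0ℚ ≤ τ
  0≤τ = ≤-trans 0≤1 1≤τ

  0<6τ : 0ℚ < 6ℚ * τ
  0<6τ = <-≤-trans (positive⁻¹ 6ℚ) (subst (_≤ 6ℚ * τ) (*-identityʳ 6ℚ) (*-monoˡ 6ℚ (nonNegative⁻¹ 6ℚ) 1≤τ))

  γ = α * τ - 1ℚ

  0<γ : 0ℚ < γ
  0<γ = subst (_< γ) (+-inverseʳ 1ℚ) (+-monoˡ-< (- 1ℚ) (subst (λ z → 1ℚ < α * z) (sym (texp-1 k)) 1<αe))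

  6τ⁻¹ = inverse 0<6τ
  -- Of the six shares of ζ, one each pays for `f n` and for 1/κ, one for `e`, and three are used as
  -- ζ N ≥ 1: two against the additive 2 in the bound on W, the third to reach 3 τ ≤ 2 τ.
  ζ = γ * proj₁ 6τ⁻¹

  0<ζ : 0ℚ < ζ
  0<ζ = positive⁻¹ ζ {{pos*pos⇒pos γ {{positive 0<γ}} (proj₁ 6τ⁻¹) {{positive (proj₁ (proj₂ 6τ⁻¹))}}}}

  0≤ζ = <⇒≤ 0<ζ

  6τζ≡γ : 6ℚ * τ * ζ ≡ γ
  6τζ≡γ = trans (solve 3 (λ x g r → x :* (g :* r) := x :* r :* g) refl (6ℚ * τ) γ (proj₁ 6τ⁻¹))
    (trans (cong (_* γ) (proj₂ (proj₂ 6τ⁻¹))) (*-identityˡ γ))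

  1/ζ = archimedean 0<ζ 1ℚ

  κ = ι (suc (proj₁ 1/ζ))
  1≤κ : 1ℚ ≤ κ
  1≤κ = ≤-by (ι (proj₁ 1/ζ)) (0≤ι (proj₁ 1/ζ)) refl

  κ⁻¹ = inverse (0<ι-suc (proj₁ 1/ζ))
  r = proj₁ κ⁻¹

  r≤ζ : r ≤ ζ
  r≤ζ = begin
    r             ≡⟨ *-identityʳ r ⟨
    r * 1ℚ        ≤⟨ *-monoˡ r (<⇒≤ (proj₁ (proj₂ κ⁻¹))) (proj₂ 1/ζ) ⟩
    r * (ζ * κ)   ≡⟨ solve 3 (λ r ζ κ → r :* (ζ :* κ) := κ :* r :* ζ) refl r ζ κ ⟩
    κ * r * ζ     ≡⟨ cong (_* ζ) (proj₂ (proj₂ κ⁻¹)) ⟩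
    1ℚ * ζ        ≡⟨ *-identityˡ ζ ⟩
    ζ             ∎
    where open ≤-Reasoning

  eventually = f→0 ζ 0<ζ
  -- The sum puts n beyond both the point from which f ≤ ζ and 1/ζ.
  k₀ = proj₁ eventually ℕ.+ proj₁ 1/ζ
  n = suc k₀
  N = ι n

  fn≤ζ : f n ≤ ζ
  fn≤ζ = proj₂ (proj₂ eventually n (ℕₚ.m≤n⇒m≤1+n (ℕₚ.m≤m+n _ _)))

  1≤ζN : 1ℚ ≤ ζ * N
  1≤ζN = ≤-trans (proj₂ 1/ζ) (*-monoˡ ζ 0≤ζ (ι-mono (ℕ.s≤s (ℕₚ.m≤n+m _ (proj₁ eventually)))))

  -- δ = 1/ρ depends on n and l on δ: ρ ≥ 2N/ζ and L ≥ 2ρ/ζ give N δ L ≤ ζ L / 2 and ρ ≤ ζ L / 2, so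
  -- that e ≤ ζ L.
  large-ρ = archimedean 0<ζ (2ℚ * N)
  ρ = ι (suc (proj₁ large-ρ))
  0≤ρ = 0≤ι (suc (proj₁ large-ρ))
  ρ⁻¹ = inverse (0<ι-suc (proj₁ large-ρ))
  δ = proj₁ ρ⁻¹
  0≤δ = <⇒≤ (proj₁ (proj₂ ρ⁻¹))
  ρδ≡1 = proj₂ (proj₂ ρ⁻¹)
  q = 1ℚ - δ

  δ≤1 : δ ≤ 1ℚ
  δ≤1 = subst₂ _≤_ (*-identityˡ δ) ρδ≡1 (*-monoʳ δ 0≤δ (≤-by {1ℚ} {ρ} (ι (proj₁ large-ρ)) (0≤ι (proj₁ large-ρ)) refl))

  2Nδ≤ζ : 2ℚ * N * δ ≤ ζ
  2Nδ≤ζ = ≤-trans (*-monoʳ δ 0≤δ (proj₂ large-ρ))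
    (≤-reflexive (trans (*-assoc ζ ρ δ) (trans (cong (ζ *_) ρδ≡1) (*-identityʳ ζ))))

  large-l = archimedean 0<ζ (2ℚ * ρ)
  l = suc (proj₁ large-l)
  L = ι l
  0≤L = 0≤ι l

  q+δ≡1 : q + δ ≡ 1ℚ
  q+δ≡1 = solve 1 (λ δ → con 1ℚ :- δ :+ δ := con 1ℚ) refl δ

  open Play A n κ 1≤κ using (module Averages)
  open Averages q δ (0≤-gap δ≤1) 0≤δ q+δ≡1 using (onMaximum; onAny; 0≤onAny)
  open Accumulated A n κ 1≤κ q δ (0≤-gap δ≤1) 0≤δ q+δ≡1

  e = ρ + N * δ * L
  0≤e : 0ℚ ≤ e
  0≤e = 0≤+ 0≤ρ (0≤* (0≤* (0≤ι n) 0≤δ) 0≤L)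

  optimum = secretary-bound k n (totalOnMaximum l) (totalOnAny l) e L 0≤e
    (λ i → 0≤∑ l (0≤onAny i))
    (λ i i<n → total-comparison l ρ 0≤ρ ρδ≡1 i (ℕₚ.<⇒≤ i<n))
    (total-budget l)
  W = proj₁ optimum

  total≥ : L * (N * (α - f n - r)) ≤ ∑ n (totalOnMaximum l)
  total≥ = total-≥ l (N * (α - f n - r)) (λ m →
    competitive⇒onMaximum k₀ (α - f n) r m refl (proj₂ (proj₂ κ⁻¹)) (competitive n))

  -- All error terms are at most ζ N, and ζ is chosen so that α τ = 1 + 6 τ ζ.
  scaled : L * (3ℚ * τ) ≤ L * (2ℚ * τ)
  scaled = *-cancelˡ-≤-pos 2ℚ (≤-by
      (2ℚ * τ * (N * e + W * L - L * (N * (α - f n - r)))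
        + 2ℚ * L * (N + 2ℚ * τ - W * τ)
        + 2ℚ * τ * L * N * ((ζ - f n) + (ζ - r))
        + τ * N * ((ζ * L - 2ℚ * ρ) + (ζ - 2ℚ * N * δ) * L)
        + 6ℚ * τ * L * (ζ * N - 1ℚ))
      (0≤+ (0≤+ (0≤+ (0≤+
        (0≤* (0≤* 0≤2 0≤τ) (0≤-gap (≤-trans total≥ (proj₂ (proj₂ optimum)))))
        (0≤* (0≤* 0≤2 0≤L) (0≤-gap (proj₁ (proj₂ optimum)))))
        (0≤* (0≤* (0≤* (0≤* 0≤2 0≤τ) 0≤L) (0≤ι n)) (0≤+ (0≤-gap fn≤ζ) (0≤-gap r≤ζ))))
        (0≤* (0≤* 0≤τ (0≤ι n)) (0≤+ (0≤-gap (proj₂ large-l)) (0≤* (0≤-gap 2Nδ≤ζ) 0≤L))))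
        (0≤* (0≤* (0≤* (nonNegative⁻¹ 6ℚ) 0≤τ) 0≤L) (0≤-gap 1≤ζN)))
      (trans
        (identity α τ (f n) r ζ N L ρ δ W)
        (trans (cong (λ z → 2ℚ * (L * (2ℚ * τ)) + 2ℚ * L * N * (z - γ)) 6τζ≡γ)
          (solve 3 (λ x y γ → x :+ y :* (γ :- γ) := x) refl (2ℚ * (L * (2ℚ * τ))) (2ℚ * L * N) γ))))
    where
    0≤2 = nonNegative⁻¹ 2ℚ
    identity = λ α τ f r ζ N L ρ δ W → solve 10 (λ α τ f r ζ N L ρ δ W →
      con 2ℚ :* (L :* (con 3ℚ :* τ))
        :+ (con 2ℚ :* τ :* (N :* (ρ :+ N :* δ :* L) :+ W :* L :- L :* (N :* (α :- f :- r)))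
          :+ con 2ℚ :* L :* (N :+ con 2ℚ :* τ :- W :* τ)
          :+ con 2ℚ :* τ :* L :* N :* ((ζ :- f) :+ (ζ :- r))
          :+ τ :* N :* ((ζ :* L :- con 2ℚ :* ρ) :+ (ζ :- con 2ℚ :* N :* δ) :* L)
          :+ con 6ℚ :* τ :* L :* (ζ :* N :- con 1ℚ))
      := con 2ℚ :* (L :* (con 2ℚ :* τ)) :+ con 2ℚ :* L :* N :* (con 6ℚ :* τ :* ζ :- (α :* τ :- con 1ℚ)))
      refl α τ f r ζ N L ρ δ W

  τ≤0 : τ ≤ 0ℚ
  τ≤0 = ≤-by (2ℚ * τ - 3ℚ * τ) (0≤-gap (*-cancelˡ-≤-pos L {{positive (0<ι-suc (proj₁ large-l))}} scaled))
    (solve 1 (λ τ → τ :+ (con 2ℚ :* τ :- con 3ℚ :* τ) := con 0ℚ) refl τ)
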